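{- Let $M=(E,r)$ be a matroid with $E$ nonempty, and write $r(M)=r(E)$. Then \[ T_M(x,y)=-\,\frac{(xy-x-y)^{|E|-1}}{(-y)^{r(M)-1}(-x)^{|E|-r(M)-1}}\cdot Q'_M\!\left(\frac{ -x}{xy-x-y},\ \frac{ -y}{xy-x-y}\right). \]
   Context: For a polymatroid (in particular a matroid) $M=(E,r)$ with ground set $E$, a base is a vector $\mathbf x\in\mathbb Z^E$ with $\sum_{i\in E}x_i=r(E)$ and $\sum_{i\in S}x_i\le r(S)$ for all $S\subseteq E$; $P(M)$ is the convex hull of the bases. For a matroid, the bases are exactly the indicator vectors $\mathbf e_B$ of the matroid bases $B$. Let $\Delta=\operatorname{conv}\{\mathbf e_i:i\in E\}\subseteq\mathbb R^E$ and $\nabla=-\Delta$. For integers $t,u\ge 0$ let $Q_M(t,u)=\#\big((P(M)+u\Delta+t\nabla)\cap\mathbb Z^E\big)$ (Minkowski sum). This is a polynomial in $t,u$ (of degree $|E|-1$); write it uniquely as $Q_M(t,u)=\sum_{i,j}c_{ij}\binom{u}{j}\binom{t}{i}$ and define $Q'_M(x,y)=\sum_{i,j}c_{ij}(x-1)^i(y-1)^j$. The Tutte polynomial is $T_M(x,y)=\sum_{S\subseteq E}(x-1)^{r(E)-r(S)}(y-1)^{|S|-r(S)}$.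
   Formalization: The polytopes P(M), Δ, ∇ and their Minkowski sums are taken in ℚ^E with rational convex weights instead of in ℝ^E; their integer points are the same, since a rational linear system solvable over the reals is solvable over the rationals. -}

module Defs where

open import Algebra.Bundles using (CommutativeRing; Semiring)
import Algebra.Definitions.RawMonoid
import Algebra.Definitions.RawSemiring
import Algebra.Properties.CommutativeSemigroup
import Algebra.Properties.Ring
open import Data.Bool.Base using (if_then_else_)
open import Data.Fin.Base using (Fin; toℕ)
open import Data.Fin.Subset using (Subset; inside; outside; ⊤; _⊆_; _∪_; _∩_; ∣_∣)
open import Data.Integer.Base as ℤ using (ℤ; +_; -[1+_])
import Data.Integer.Properties as ℤ
open import Data.List.Base as List using (List; length)
open import Data.List.Membership.Propositional using (_∈_)
open import Data.List.Relation.Unary.All using (All)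
open import Data.List.Relation.Unary.Unique.Propositional using (Unique)
open import Data.Nat.Base as ℕ using (ℕ; zero; suc)
open import Data.Nat.Combinatorics using (_C_)
open import Data.Product.Base using (_×_; _,_; proj₁; proj₂; ∃-syntax)
open import Data.Rational.Base as ℚ using (ℚ; 0ℚ; 1ℚ)
open import Data.Vec.Base as Vec using (Vec; []; _∷_; zipWith; replicate; _[_]≔_)
open import Function.Bundles using (_⇔_)
open import Level using (Level; _⊔_; 0ℓ)
open import Relation.Binary.PropositionalEquality using (_≡_)
open import Relation.Unary using (Pred)

-- The ground set E is Fin n throughout, so n = |E|.

record Matroid (n : ℕ) : Set where
  field
    rank        : Subset n → ℕ
    rank-≤      : ∀ S → rank S ℕ.≤ ∣ S ∣
    rank-mono   : ∀ {S T} → S ⊆ T → rank S ℕ.≤ rank T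
    rank-submod : ∀ S T → rank (S ∪ T) ℕ.+ rank (S ∩ T) ℕ.≤ rank S ℕ.+ rank T

  totalRank : ℕ
  totalRank = rank ⊤

sumOver : ∀ {n} → Subset n → Vec ℤ n → ℤ
sumOver S x = Vec.foldr′ ℤ._+_ ℤ.0ℤ (zipWith (λ s z → if s then z else ℤ.0ℤ) S x)

IsBase : ∀ {n} → Matroid n → Pred (Vec ℤ n) 0ℓ
IsBase M x = sumOver ⊤ x ≡ + rank ⊤ × (∀ S → sumOver S x ℤ.≤ + rank S)
  where open Matroid M

-- Polytopes are subsets of ℚ^E instead of ℝ^E. All the polytopes below are
-- rational, and a system of linear inequalities with rational coefficients is
-- solvable over ℝ iff it is over ℚ, so they contain the same lattice points.

infixl 6 _+ᵛ_ _⊕_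
infixr 7 _*ᵛ_ _⊛_

_+ᵛ_ : ∀ {n} → Vec ℚ n → Vec ℚ n → Vec ℚ n
_+ᵛ_ = zipWith ℚ._+_

_*ᵛ_ : ∀ {n} → ℚ → Vec ℚ n → Vec ℚ n
a *ᵛ v = Vec.map (a ℚ.*_) v

0ᵛ : ∀ {n} → Vec ℚ n
0ᵛ {n} = replicate n 0ℚ

-ᵛ_ : ∀ {n} → Vec ℚ n → Vec ℚ n
-ᵛ_ = Vec.map (λ a → ℚ.- a)

ℤ→ℚ : ∀ {n} → Vec ℤ n → Vec ℚ n
ℤ→ℚ = Vec.map (ℚ._/ 1)

e : ∀ {n} → Fin n → Vec ℚ n
e i = 0ᵛ [ i ]≔ 1ℚ

-- A convex combination is a finite list of (weight , point) pairs.
conv : ∀ {n ℓ} → Pred (Vec ℚ n) ℓ → Pred (Vec ℚ n) ℓ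
conv {n} A p = ∃[ ws ]
  All (λ (w : ℚ × Vec ℚ n) → 0ℚ ℚ.≤ proj₁ w × A (proj₂ w)) ws ×
  List.foldr ℚ._+_ 0ℚ (List.map proj₁ ws) ≡ 1ℚ ×
  List.foldr _+ᵛ_ 0ᵛ (List.map (λ (a , v) → a *ᵛ v) ws) ≡ p

_⊕_ : ∀ {n ℓ₁ ℓ₂} → Pred (Vec ℚ n) ℓ₁ → Pred (Vec ℚ n) ℓ₂ → Pred (Vec ℚ n) (ℓ₁ ⊔ ℓ₂)
(A ⊕ B) p = ∃[ a ] ∃[ b ] A a × B b × p ≡ a +ᵛ b

_⊛_ : ∀ {n ℓ} → ℕ → Pred (Vec ℚ n) ℓ → Pred (Vec ℚ n) ℓ
(k ⊛ A) p = ∃[ a ] A a × p ≡ (+ k ℚ./ 1) *ᵛ a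

basePolytope : ∀ {n} → Matroid n → Pred (Vec ℚ n) 0ℓ
basePolytope M = conv (λ p → ∃[ x ] IsBase M x × p ≡ ℤ→ℚ x)

Δ : ∀ {n} → Pred (Vec ℚ n) 0ℓ
Δ = conv (λ p → ∃[ i ] p ≡ e i)

∇ : ∀ {n} → Pred (Vec ℚ n) 0ℓ
∇ p = ∃[ d ] Δ d × p ≡ -ᵛ d

LatticePoint : ∀ {n} → Matroid n → (t u : ℕ) → Pred (Vec ℤ n) 0ℓ
LatticePoint M t u q = (basePolytope M ⊕ u ⊛ Δ ⊕ t ⊛ ∇) (ℤ→ℚ q)

HasCardinality : ∀ {a ℓ} {A : Set a} → Pred A ℓ → ℕ → Set (a ⊔ ℓ)
HasCardinality {A = A} P k = ∃[ xs ]
  Unique xs × (∀ (a : A) → a ∈ xs ⇔ P a) × length xs ≡ k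

module _ where
  open Algebra.Definitions.RawMonoid ℤ.+-0-rawMonoid using (sum)

  -- Q_M together with its expansion in the binomial basis. This data is unique
  -- up to padding `coeff` by zeros. The coefficients are integers because they
  -- are iterated differences of the integer-valued Q_M.
  record LatticeCount {n : ℕ} (M : Matroid n) : Set where
    field
      Q         : (t u : ℕ) → ℕ
      Q-counts  : ∀ t u → HasCardinality (LatticePoint M t u) (Q t u)
      size      : ℕ
      coeff     : (i j : Fin size) → ℤ
      expansion : ∀ t u → + Q t u ≡
        sum (λ i → sum (λ j → coeff i j ℤ.* + (u C toℕ j) ℤ.* + (t C toℕ i)))

module Evaluation {c ℓ : Level} (R : CommutativeRing c ℓ) where
  open CommutativeRing R
    renaming (_+_ to infixl 6 _+_; _*_ to infixl 7 _*_; -_ to infix 8 -_)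
  open Algebra.Definitions.RawSemiring (Semiring.rawSemiring semiring) using (sum; _^_) renaming (_×_ to _·_)

  fromℤ : ℤ → Carrier
  fromℤ (+ k)    = k · 1#
  fromℤ -[1+ k ] = - (suc k · 1#)

  sumSubsets : ∀ {n} → (Subset n → Carrier) → Carrier
  sumSubsets {zero}  f = f []
  sumSubsets {suc n} f = sumSubsets (λ S → f (outside ∷ S)) + sumSubsets (λ S → f (inside ∷ S))

  -- Both truncated subtractions are exact, by rank-mono and rank-≤.
  tutte : ∀ {n} → Matroid n → Carrier → Carrier → Carrier
  tutte M x y = sumSubsets λ S →
    (x - 1#) ^ (rank ⊤ ℕ.∸ rank S) * (y - 1#) ^ (∣ S ∣ ℕ.∸ rank S)
    where open Matroid M

  Q′ : ∀ {n} {M : Matroid n} → LatticeCount M → Carrier → Carrier → Carrier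
  Q′ L x y = sum (λ i → sum (λ j →
    fromℤ (coeff i j) * (x - 1#) ^ toℕ i * (y - 1#) ^ toℕ j))
    where open LatticeCount L

  record Unit : Set (c ⊔ ℓ) where
    field
      val        : Carrier
      inv        : Carrier
      val*inv≈1# : val * inv ≈ 1#

  open Unit public

  private
    open Algebra.Properties.Ring ring using (-‿distribˡ-*; -‿distribʳ-*; -‿involutive)
    open Algebra.Properties.CommutativeSemigroup *-commutativeSemigroup using (interchange)

  1ᵘ : Unit
  1ᵘ = record { val = 1# ; inv = 1# ; val*inv≈1# = *-identityˡ 1# }

  infixl 7 _*ᵘ_ _/ᵘ_
  infix  8 -ᵘ_
  infixr 8 _^ᶻ_

  _*ᵘ_ : Unit → Unit → Unit
  a *ᵘ b = record
    { val        = val a * val b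
    ; inv        = inv a * inv b
    ; val*inv≈1# = trans (interchange (val a) (val b) (inv a) (inv b))
                     (trans (*-cong (val*inv≈1# a) (val*inv≈1# b)) (*-identityˡ 1#))
    }

  _⁻¹ᵘ : Unit → Unit
  a ⁻¹ᵘ = record
    { val        = inv a
    ; inv        = val a
    ; val*inv≈1# = trans (*-comm (inv a) (val a)) (val*inv≈1# a)
    }

  -ᵘ_ : Unit → Unit
  -ᵘ a = record
    { val        = - val a
    ; inv        = - inv a
    ; val*inv≈1# = trans (sym (-‿distribˡ-* (val a) (- inv a)))
                     (trans (-‿cong (sym (-‿distribʳ-* (val a) (inv a))))
                       (trans (-‿involutive (val a * inv a)) (val*inv≈1# a)))
    }

  _^ᵘ_ : Unit → ℕ → Unit
  a ^ᵘ zero  = 1ᵘ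
  a ^ᵘ suc k = a *ᵘ (a ^ᵘ k)

  _^ᶻ_ : Unit → ℤ → Unit
  a ^ᶻ (+ k)    = a ^ᵘ k
  a ^ᶻ -[1+ k ] = (a ^ᵘ suc k) ⁻¹ᵘ

  _/ᵘ_ : Carrier → Unit → Carrier
  a /ᵘ b = a * inv b

  -- Equality of rational functions in x and y is expressed by evaluation at all
  -- points of all commutative rings at which the denominators are invertible;
  -- R = ℚ(x,y) gives the identity of rational functions itself. The exponents
  -- r(M)-1 and |E|-r(M)-1 can be -1, hence the integer powers.
  TutteFormula : ∀ {n} (M : Matroid n) → LatticeCount M → Set (c ⊔ ℓ)
  TutteFormula {n} M L = ∀ (x y w : Unit) → val w ≈ val x * val y - val x - val y →
    tutte M (val x) (val y) ≈
      - ((val w ^ (n ℕ.∸ 1) /ᵘ ((-ᵘ y) ^ᶻ (+ r ℤ.- + 1) *ᵘ (-ᵘ x) ^ᶻ (+ n ℤ.- + r ℤ.- + 1)))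
         * Q′ L ((- val x) /ᵘ w) ((- val y) /ᵘ w))
    where
    r : ℕ
    r = Matroid.totalRank M

{-# OPTIONS --safe #-}

-- Fix the first element e of the ground set. A lattice point q of
-- P(M) + uΔ + t∇ is determined by its other coordinates v, and if A is the set of
-- coordinates at which v is positive, q is a lattice point iff the positive part
-- of v has sum at most u + r(A) and the negative part has sum at most
-- t - γ, where γ = r(E) - r(A ∪ e). (Sufficiency: a greedy base x with x(pos q) = r(pos q)
-- makes the positive part of q - x have sum at most u.) Hence, with a = |A| and
-- b = |E| - 1 - a,
--   Q_M(t,u) = Σ_A C(u + r(A), a) C(t + b - γ, b).
-- Replacing C(u,j) by z^j turns C(u + β, a) into (1 + z)^β z^(a - β), so
--   Q'_M(X,Y) = Σ_A Y^r(A) (Y-1)^(a - r(A)) X^(b - γ) (X-1)^γ,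
-- and at X = -x/w, Y = -y/w, where X - 1 = -y(x-1)/w and Y - 1 = -x(y-1)/w, the
-- summand of A becomes, up to the common prefactor, the sum of the two terms
-- S = A and S = A ∪ e of the Tutte polynomial.

module Submission where

open import Defs
open import Algebra.Bundles using (CommutativeRing; CommutativeMonoid; Semiring)
import Algebra.Definitions.RawMonoid as RawMonoid
import Algebra.Definitions.RawSemiring as RawSemiring
import Algebra.Properties.CommutativeMonoid.Sum as CommutativeMonoidSum
import Algebra.Properties.CommutativeSemigroup as CommutativeSemigroup
import Algebra.Properties.CommutativeSemiring.Exp as CommutativeSemiringExp
import Algebra.Properties.Ring as RingProperties
import Algebra.Properties.Semiring.Exp as SemiringExp
import Algebra.Properties.Semiring.Mult as SemiringMult
import Algebra.Properties.Semiring.Sum as SemiringSum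
import Algebra.Solver.Ring.NaturalCoefficients.Default as SemiringSolver
open import Data.Bool.Base using (Bool; if_then_else_)
open import Data.Empty using (⊥-elim)
open import Data.Fin.Base using (Fin; zero; suc; toℕ)
import Data.Fin.Properties as Fin
open import Data.Fin.Subset using (Subset; inside; outside; ⊤; ⊥; ∁; ∣_∣; _∪_; _∩_; ⁅_⁆)
import Data.Fin.Subset.Properties as Subset
open import Data.Integer.Base as ℤ using (ℤ; +_; -[1+_]; _⊖_)
import Data.Integer.Properties as ℤ
import Data.Integer.Tactic.RingSolver as ℤ-Solver
open import Data.List.Base as List using (List; []; _∷_)
open import Data.List.Membership.Propositional using (_∈_)
open import Data.List.Membership.Propositional.Properties using (∈-map⁺; ∈-map⁻; ++-∈⇔; ∈-lookup)
import Data.List.Properties as List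
open import Data.List.Relation.Unary.All as All using (All; []; _∷_)
import Data.List.Relation.Unary.All.Properties as All
open import Data.List.Relation.Unary.AllPairs using ([]; _∷_)
open import Data.List.Relation.Unary.Any using (here; there; index)
open import Data.List.Relation.Unary.Any.Properties using (lookup-index)
open import Data.List.Relation.Unary.Unique.Propositional using (Unique)
import Data.List.Relation.Unary.Unique.Propositional.Properties as Unique
open import Data.Nat.Base as ℕ using (ℕ; zero; suc; NonZero)
open import Data.Nat.Combinatorics using (_C_; nCn≡1; nCk+nC[k+1]≡[n+1]C[k+1])
open import Data.Nat.Combinatorics.Specification using (k>n⇒nCk≡0)
import Data.Nat.Properties as ℕ
import Data.Nat.Tactic.RingSolver as ℕ-Solver
open import Data.Product.Base using (_×_; _,_; proj₁; proj₂; ∃-syntax; map₂)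
open import Data.Rational.Base as ℚ using (ℚ; 0ℚ; 1ℚ)
import Data.Rational.Properties as ℚ
import Data.Rational.Unnormalised.Base as ℚᵘ
import Data.Rational.Unnormalised.Properties as ℚᵘ
open import Data.Sum.Base using (_⊎_; inj₁; inj₂)
open import Data.Sum.Function.Propositional using (_⊎-⇔_)
open import Data.Vec.Base as Vec using (Vec; []; _∷_)
open import Data.Vec.Properties using (∷-injective; ∷-injectiveʳ; zipWith-identityʳ)
open import Data.Vec.Relation.Unary.All as VecAll using ([]; _∷_)
import Data.Vec.Relation.Unary.All.Properties as VecAll
open import Function.Base using (_∘_; case_of_)
open import Function.Bundles using (_⇔_; mk⇔; module Equivalence)
open import Function.Construct.Composition using (_⇔-∘_)
open import Level using (Level; 0ℓ)
open import Relation.Binary.Core using (Rel)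
open import Relation.Binary.PropositionalEquality as ≡ using (_≡_)
import Relation.Binary.Reasoning.Setoid as SetoidReasoning
open import Relation.Nullary.Decidable.Core using (yes; no)
open import Relation.Nullary.Negation using (¬_)
open import Relation.Unary using (Pred)

-- A point q of P(M) + uΔ + t∇ satisfies q(S) ≤ r(S) + u for every S, and its total q(E) is fixed;
-- the instances S = A and S = A ∪ e are the two conditions on v. Conversely one inequality is
-- enough, the one for the positive set of q, which is A or A ∪ e according to the sign of q at e.
-- This rests on bases being 0/1 vectors: subtracting one from q creates no positive coordinate
-- outside the positive set and no negative coordinate inside it. The formula is claimed for every
-- `LatticeCount`, whose coefficients are arbitrary data. They are never compared: the replacement
-- of binomials by powers is a linear operator on functions of t and u, and the values of `Q` are
-- determined because a set has only one cardinality. The last step depends on whether e raises the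
-- rank of A. After all powers of w cancel, exactly one factor x or y is left over, and writing it
-- as 1 + (x - 1) or 1 + (y - 1) yields the terms of the two subsets A and A ∪ e.

-- Finite cardinalities: uniqueness, disjoint unions, images and fibres.

module Cardinality where
  open ≡
  open import Data.Nat.Base using (_+_; _≤_)
  open import Data.List.Base using (_++_; length; lookup)
  open import Data.Vec.Base using (head; tail)
  open Equivalence using (to; from)

  private
    variable
      a b p q : Level
      A : Set a
      B : Set b
      P : Pred A p
      Q : Pred A q

  lookup-injective : {xs : List A} → Unique xs → ∀ {i j} → lookup xs i ≡ lookup xs j → i ≡ j
  lookup-injective (_ ∷ _)     {zero}  {zero}  _  = refl
  lookup-injective (x∉xs ∷ _) {zero}  {suc j} eq = ⊥-elim (All.lookup x∉xs (∈-lookup j) eq)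
  lookup-injective (x∉xs ∷ _) {suc i} {zero}  eq = ⊥-elim (All.lookup x∉xs (∈-lookup i) (sym eq))
  lookup-injective (_ ∷ xs!)  {suc i} {suc j} eq = cong suc (lookup-injective xs! eq)

  -- Pigeonhole: sending each position of `xs` to the position of its entry in `ys` is injective,
  -- since equal positions give equal entries and `xs` has no repetitions.
  card-≤ : {xs ys : List A} → Unique xs → (∀ {a} → a ∈ xs → a ∈ ys) → length xs ≤ length ys
  card-≤ {xs = xs} {ys} xs! xs⊆ys = Fin.injective⇒≤ {f = λ i → index (xs⊆ys (∈-lookup i))}
    λ {i} {j} eq → lookup-injective xs! (begin
      lookup xs i                              ≡⟨ lookup-index (xs⊆ys (∈-lookup i)) ⟩
      lookup ys (index (xs⊆ys (∈-lookup i)))   ≡⟨ cong (lookup ys) eq ⟩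
      lookup ys (index (xs⊆ys (∈-lookup j)))   ≡⟨ lookup-index (xs⊆ys (∈-lookup j)) ⟨
      lookup xs j                              ∎)
    where open ≡-Reasoning

  card-unique : ∀ {j k} → HasCardinality P j → HasCardinality P k → j ≡ k
  card-unique (xs , xs! , xs-iff , refl) (ys , ys! , ys-iff , refl) = ℕ.≤-antisym
    (card-≤ xs! λ {a} → λ a∈ → from (ys-iff a) (to (xs-iff a) a∈))
    (card-≤ ys! λ {a} → λ a∈ → from (xs-iff a) (to (ys-iff a) a∈))

  card-resp : ∀ {k} → (∀ a → P a ⇔ Q a) → HasCardinality P k → HasCardinality Q k
  card-resp P⇔Q (xs , xs! , iff , eq) = xs , xs! , (λ a → P⇔Q a ⇔-∘ iff a) , eq

  card-∅ : (∀ a → ¬ P a) → HasCardinality P 0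
  card-∅ ¬P = [] , [] , (λ a → mk⇔ (λ ()) (λ pa → ⊥-elim (¬P a pa))) , refl

  card-singleton : (c : A) → HasCardinality (_≡ c) 1
  card-singleton c = c ∷ [] , [] ∷ [] , (λ a → mk⇔ (λ { (here eq) → eq ; (there ()) }) here) , refl

  card-⊎ : ∀ {j k} → (∀ a → P a → ¬ Q a) → HasCardinality P j → HasCardinality Q k →
           HasCardinality (λ a → P a ⊎ Q a) (j + k)
  card-⊎ disj (xs , xs! , xs-iff , refl) (ys , ys! , ys-iff , refl) =
    xs ++ ys ,
    Unique.++⁺ xs! ys! (λ {a} → λ (a∈xs , a∈ys) → disj a (to (xs-iff a) a∈xs) (to (ys-iff a) a∈ys)) ,
    (λ a → (xs-iff a ⊎-⇔ ys-iff a) ⇔-∘ ++-∈⇔) ,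
    List.length-++ xs

  card-image : ∀ {k} (f : A → B) → (∀ {x y} → f x ≡ f y → x ≡ y) → HasCardinality P k →
               HasCardinality (λ b → ∃[ a ] P a × b ≡ f a) k
  card-image {P = P} f inj (xs , xs! , iff , refl) =
    List.map f xs , Unique.map⁺ inj xs! , (λ b → mk⇔ to′ from′) , List.length-map f xs
    where
    to′ : ∀ {b} → b ∈ List.map f xs → ∃[ a ] P a × b ≡ f a
    to′ b∈ with a , a∈ , eq ← ∈-map⁻ f b∈ = a , to (iff a) a∈ , eq
    from′ : ∀ {b} → ∃[ a ] P a × b ≡ f a → b ∈ List.map f xs
    from′ (a , pa , refl) = ∈-map⁺ f (from (iff a) pa)

  -- Same recursion on the first bit as `sumSubsets`, so that the two are compared by structural
  -- induction.
  subsetSum : ∀ {m} → (Subset m → ℕ) → ℕ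
  subsetSum {zero}  f = f []
  subsetSum {suc m} f = subsetSum (λ S → f (outside ∷ S)) + subsetSum (λ S → f (inside ∷ S))

  -- Induction on the length of the key: its first bit splits the set into two disjoint pieces, and
  -- each piece is fibred again over the remaining bits.
  card-fibres : ∀ {m} {k : Subset m → ℕ} (key : A → Subset m) →
                (∀ S → HasCardinality (λ a → key a ≡ S × P a) (k S)) →
                HasCardinality P (subsetSum k)
  card-fibres {m = zero} key h = card-resp (λ a → mk⇔ proj₂ (λ pa → []-unique (key a) , pa)) (h [])
    where
    []-unique : (S : Subset 0) → S ≡ []
    []-unique [] = refl
  card-fibres {P = P} {m = suc m} {k} key h =
    card-resp (λ a → mk⇔ (λ { (inj₁ (_ , pa)) → pa ; (inj₂ (_ , pa)) → pa }) (λ pa → split (key a) refl pa))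
      (card-⊎ (λ a (eq , _) (eq′ , _) → case trans (sym eq) eq′ of λ ()) (fibre outside) (fibre inside))
    where
    split : ∀ {a} S → key a ≡ S → P a → (head (key a) ≡ outside × P a) ⊎ (head (key a) ≡ inside × P a)
    split (outside ∷ S) eq pa = inj₁ (cong head eq , pa)
    split (inside  ∷ S) eq pa = inj₂ (cong head eq , pa)
    uncons : ∀ {s} (S : Subset (suc m)) T → tail S ≡ T → head S ≡ s → S ≡ s ∷ T
    uncons (_ ∷ _) _ refl refl = refl
    fibre : ∀ s → HasCardinality (λ a → head (key a) ≡ s × P a) (subsetSum (λ S → k (s ∷ S)))
    fibre s = card-fibres (λ a → tail (key a)) λ S →
      card-resp (λ a → mk⇔ (λ (eq , pa) → cong tail eq , cong head eq , pa)
                           (λ (eq , eq′ , pa) → uncons (key a) S eq eq′ , pa))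
                (h (s ∷ S))

-- Integer vectors with a prescribed positive set and bounded positive and negative parts.

module Orthants where
  open ≡
  open import Data.Nat.Base using (_+_; _*_; _≤_; z≤n; s≤s)
  open import Data.Vec.Base using (map; sum)
  open Cardinality

  -- Zero is put on the negative side, so coordinates in the positive set are at least 1 while the
  -- others may vanish. This asymmetry is the source of the two different binomials in
  -- `card-orthant`.
  isPos : ℤ → Bool
  isPos (+ zero)  = outside
  isPos (+ suc _) = inside
  isPos -[1+ _ ]  = outside

  pos : ∀ {m} → Vec ℤ m → Subset m
  pos = map isPos

  posPart negPart : ℤ → ℕ
  posPart (+ k)    = k
  posPart -[1+ _ ] = 0
  negPart (+ _)    = 0
  negPart -[1+ k ] = suc k

  plus minus : ∀ {m} → Vec ℤ m → ℕ
  plus  v = sum (map posPart v)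
  minus v = sum (map negPart v)

  mapHead : ∀ {A : Set} {m} → (A → A) → Vec A (suc m) → Vec A (suc m)
  mapHead f (z ∷ v) = f z ∷ v

  mapHead-injective : ∀ {m} {f : ℤ → ℤ} → (∀ {y z} → f y ≡ f z → y ≡ z) →
                      {v w : Vec ℤ (suc m)} → mapHead f v ≡ mapHead f w → v ≡ w
  mapHead-injective inj {_ ∷ _} {_ ∷ _} eq with fy≡fz , refl ← ∷-injective eq = cong (_∷ _) (inj fy≡fz)

  ℤsuc-injective : ∀ {y z} → ℤ.suc y ≡ ℤ.suc z → y ≡ z
  ℤsuc-injective {y} {z} eq = trans (sym (ℤ.pred-suc y)) (trans (cong ℤ.pred eq) (ℤ.pred-suc z))

  ℤpred-injective : ∀ {y z} → ℤ.pred y ≡ ℤ.pred z → y ≡ z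
  ℤpred-injective {y} {z} eq = trans (sym (ℤ.suc-pred y)) (trans (cong ℤ.suc eq) (ℤ.suc-pred z))

  InOrthant : ∀ {m} → Subset m → ℕ → ℕ → Vec ℤ m → Set
  InOrthant A P K v = pos v ≡ A × plus v ≤ P × minus v ≤ K

  -- The two groups of coordinates are independent: a positive integers with sum at most P can be
  -- chosen in C(P, a) ways, b nonnegative integers with sum at most K in C(K + b, b) ways. Each
  -- recursive case realises Pascal's rule by a bijection.
  card-orthant : ∀ {m} (A : Subset m) P K →
                 HasCardinality (InOrthant A P K) ((P C ∣ A ∣) * ((K + ∣ ∁ A ∣) C ∣ ∁ A ∣))
  card-orthant [] P K =
    card-resp (λ { [] → mk⇔ (λ _ → refl , z≤n , z≤n) (λ _ → refl) }) (card-singleton [])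
  card-orthant (inside ∷ A) zero K = card-∅ λ
    { (+ zero ∷ _)     (() , _)
    ; (+ suc _ ∷ _)    (_ , () , _)
    ; (-[1+ _ ] ∷ _)   (() , _)
    }
  -- The first coordinate is either 1 and is dropped, or at least 2 and is lowered by one; both
  -- moves use up one unit of the bound.
  card-orthant (inside ∷ A) (suc P) K =
    subst (HasCardinality _) count
      (card-resp iff
        (card-⊎ disjoint
          (card-image (+ 1 ∷_) ∷-injectiveʳ (card-orthant A P K))
          (card-image (mapHead ℤ.suc) (mapHead-injective ℤsuc-injective) (card-orthant (inside ∷ A) P K))))
    where
    X = (K + ∣ ∁ A ∣) C ∣ ∁ A ∣
    count : (P C ∣ A ∣) * X + (P C suc ∣ A ∣) * X ≡ (suc P C suc ∣ A ∣) * X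
    count = trans (sym (ℕ.*-distribʳ-+ X (P C ∣ A ∣) (P C suc ∣ A ∣)))
                  (cong (_* X) (nCk+nC[k+1]≡[n+1]C[k+1] P ∣ A ∣))
    disjoint : ∀ v → _ → _
    disjoint _ (_ , _ , refl) (+ zero  ∷ _ , (() , _) , _)
    disjoint _ (_ , _ , refl) (+ suc _ ∷ _ , _ , ())
    disjoint _ (_ , _ , refl) (-[1+ _ ] ∷ _ , (() , _) , _)
    iff : ∀ v → _ ⇔ InOrthant (inside ∷ A) (suc P) K v
    iff v = mk⇔ (to v) (from v)
      where
      to : ∀ v → (∃[ w ] InOrthant A P K w × v ≡ + 1 ∷ w) ⊎
                 (∃[ w ] InOrthant (inside ∷ A) P K w × v ≡ mapHead ℤ.suc w) →
           InOrthant (inside ∷ A) (suc P) K v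
      to _ (inj₁ (w , (refl , p , k) , refl)) = refl , s≤s p , k
      to _ (inj₂ (+ zero  ∷ _ , (() , _) , _))
      to _ (inj₂ (+ suc _ ∷ w , (refl , p , k) , refl)) = refl , s≤s p , k
      to _ (inj₂ (-[1+ _ ] ∷ _ , (() , _) , _))
      from : ∀ v → InOrthant (inside ∷ A) (suc P) K v →
             (∃[ w ] InOrthant A P K w × v ≡ + 1 ∷ w) ⊎
             (∃[ w ] InOrthant (inside ∷ A) P K w × v ≡ mapHead ℤ.suc w)
      from (+ zero ∷ _) (() , _)
      from (+ suc zero ∷ w) (eq , s≤s p , k) = inj₁ (w , (∷-injectiveʳ eq , p , k) , refl)
      from (+ suc (suc j) ∷ w) (eq , s≤s p , k) = inj₂ (+ suc j ∷ w , (eq , p , k) , refl)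
      from (-[1+ _ ] ∷ _) (() , _)
  card-orthant (outside ∷ A) P zero =
    subst (HasCardinality _) count
      (card-resp (λ v → mk⇔ (to v) (from v)) (card-image (+ 0 ∷_) ∷-injectiveʳ (card-orthant A P 0)))
    where
    b = ∣ ∁ A ∣
    count : (P C ∣ A ∣) * (b C b) ≡ (P C ∣ A ∣) * (suc b C suc b)
    count = cong ((P C ∣ A ∣) *_) (trans (nCn≡1 b) (sym (nCn≡1 (suc b))))
    to : ∀ v → (∃[ w ] InOrthant A P 0 w × v ≡ + 0 ∷ w) → InOrthant (outside ∷ A) P 0 v
    to _ (w , (refl , p , k) , refl) = refl , p , k
    from : ∀ v → InOrthant (outside ∷ A) P 0 v → ∃[ w ] InOrthant A P 0 w × v ≡ + 0 ∷ w
    from (+ zero ∷ w)    (eq , p , k) = w , (∷-injectiveʳ eq , p , k) , refl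
    from (+ suc _ ∷ _)   (() , _)
    from (-[1+ _ ] ∷ _)  (_ , _ , ())
  -- The first coordinate is either 0 and is dropped at no cost, or negative and is raised by one,
  -- which uses up one unit of the bound.
  card-orthant (outside ∷ A) P (suc K) =
    subst (HasCardinality _) count
      (card-resp (λ v → mk⇔ (to v) (from v))
        (card-⊎ disjoint
          (card-image (+ 0 ∷_) ∷-injectiveʳ (card-orthant A P (suc K)))
          (card-image (mapHead ℤ.pred) (mapHead-injective ℤpred-injective)
            (card-orthant (outside ∷ A) P K))))
    where
    Y = P C ∣ A ∣
    b = ∣ ∁ A ∣
    open ≡-Reasoning
    count : Y * ((suc K + b) C b) + Y * ((K + suc b) C suc b) ≡ Y * ((suc K + suc b) C suc b)
    count = begin
      Y * ((suc K + b) C b) + Y * ((K + suc b) C suc b)   ≡⟨ cong (λ k → Y * (k C b) + Y * ((K + suc b) C suc b)) (ℕ.+-suc K b) ⟨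
      Y * ((K + suc b) C b) + Y * ((K + suc b) C suc b)   ≡⟨ ℕ.*-distribˡ-+ Y ((K + suc b) C b) _ ⟨
      Y * ((K + suc b) C b + (K + suc b) C suc b)         ≡⟨ cong (Y *_) (nCk+nC[k+1]≡[n+1]C[k+1] (K + suc b) b) ⟩
      Y * ((suc K + suc b) C suc b)                       ∎
    disjoint : ∀ v → (∃[ w ] InOrthant A P (suc K) w × v ≡ + 0 ∷ w) → _
    disjoint _ (_ , _ , refl) (+ zero  ∷ _ , _ , ())
    disjoint _ (_ , _ , refl) (+ suc _ ∷ _ , (() , _) , _)
    disjoint _ (_ , _ , refl) (-[1+ _ ] ∷ _ , _ , ())
    to : ∀ v → (∃[ w ] InOrthant A P (suc K) w × v ≡ + 0 ∷ w) ⊎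
               (∃[ w ] InOrthant (outside ∷ A) P K w × v ≡ mapHead ℤ.pred w) →
         InOrthant (outside ∷ A) P (suc K) v
    to _ (inj₁ (w , (refl , p , k) , refl)) = refl , p , k
    to _ (inj₂ (+ zero  ∷ _ , (refl , p , k) , refl)) = refl , p , s≤s k
    to _ (inj₂ (+ suc _ ∷ w , (() , _) , _))
    to _ (inj₂ (-[1+ _ ] ∷ _ , (refl , p , k) , refl)) = refl , p , s≤s k
    from : ∀ v → InOrthant (outside ∷ A) P (suc K) v →
           (∃[ w ] InOrthant A P (suc K) w × v ≡ + 0 ∷ w) ⊎
           (∃[ w ] InOrthant (outside ∷ A) P K w × v ≡ mapHead ℤ.pred w)
    from (+ zero ∷ w)  (eq , p , k) = inj₁ (w , (∷-injectiveʳ eq , p , k) , refl)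
    from (+ suc _ ∷ _) (() , _)
    from (-[1+ zero ]  ∷ w) (eq , p , s≤s k) = inj₂ (+ 0 ∷ w , (eq , p , k) , refl)
    from (-[1+ suc j ] ∷ w) (eq , p , s≤s k) = inj₂ (-[1+ j ] ∷ w , (eq , p , k) , refl)

-- Sums over subsets, the greedy vector of a submodular function, and bases of a matroid.

module Bases where
  open ≡
  open import Data.Integer.Base using (0ℤ; 1ℤ; _+_; _-_; -_; _≤_)
  open import Data.Vec.Base using (zipWith; lookup)
  open ℤ-Solver using (solve-∀)
  open Orthants

  private
    variable
      n : ℕ

  a+b-b≡a : ∀ a b → a + b - b ≡ a
  a+b-b≡a = solve-∀

  +-interchange : ∀ a b c d → (a + b) + (c + d) ≡ (a + c) + (b + d)
  +-interchange = solve-∀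

  +-congˡ : ∀ a {b c} → b ≡ c → a + b ≡ a + c
  +-congˡ a = cong (λ b → a + b)

  sumOver-+ : ∀ (S : Subset n) x y → sumOver S (zipWith _+_ x y) ≡ sumOver S x + sumOver S y
  sumOver-+ []            []      []      = refl
  sumOver-+ (outside ∷ S) (_ ∷ x) (_ ∷ y) =
    trans (+-congˡ 0ℤ (sumOver-+ S x y)) (+-interchange 0ℤ 0ℤ (sumOver S x) (sumOver S y))
  sumOver-+ (inside ∷ S)  (a ∷ x) (b ∷ y) =
    trans (+-congˡ (a + b) (sumOver-+ S x y)) (+-interchange a b (sumOver S x) (sumOver S y))

  sumOver-minus : ∀ (S : Subset n) x y → sumOver S (zipWith _-_ x y) ≡ sumOver S x - sumOver S y
  sumOver-minus []            []      []      = refl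
  sumOver-minus (outside ∷ S) (a ∷ x) (b ∷ y) =
    trans (+-congˡ 0ℤ (sumOver-minus S x y)) (lemma (sumOver S x) (sumOver S y))
    where
    lemma : ∀ a b → 0ℤ + (a - b) ≡ (0ℤ + a) - (0ℤ + b)
    lemma = solve-∀
  sumOver-minus (inside ∷ S)  (a ∷ x) (b ∷ y) =
    trans (+-congˡ (a - b) (sumOver-minus S x y)) (lemma a b (sumOver S x) (sumOver S y))
    where
    lemma : ∀ a b c d → (a - b) + (c - d) ≡ (a + c) - (b + d)
    lemma = solve-∀

  sumOver-∁ : ∀ (S : Subset n) x → sumOver S x + sumOver (∁ S) x ≡ sumOver ⊤ x
  sumOver-∁ []            []      = refl
  sumOver-∁ (outside ∷ S) (a ∷ x) = trans (lemma a (sumOver S x) (sumOver (∁ S) x)) (+-congˡ a (sumOver-∁ S x))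
    where
    lemma : ∀ a b c → (0ℤ + b) + (a + c) ≡ a + (b + c)
    lemma = solve-∀
  sumOver-∁ (inside ∷ S)  (a ∷ x) = trans (lemma a (sumOver S x) (sumOver (∁ S) x)) (+-congˡ a (sumOver-∁ S x))
    where
    lemma : ∀ a b c → (a + b) + (0ℤ + c) ≡ a + (b + c)
    lemma = solve-∀

  sumOver-⊥ : ∀ (x : Vec ℤ n) → sumOver ⊥ x ≡ 0ℤ
  sumOver-⊥ []      = refl
  sumOver-⊥ (_ ∷ x) = trans (ℤ.+-identityˡ _) (sumOver-⊥ x)

  sumOver-⁅⁆ : ∀ i (x : Vec ℤ n) → sumOver ⁅ i ⁆ x ≡ lookup x i
  sumOver-⁅⁆ zero    (a ∷ x) = trans (+-congˡ a (sumOver-⊥ x)) (ℤ.+-identityʳ a)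
  sumOver-⁅⁆ (suc i) (_ ∷ x) = trans (ℤ.+-identityˡ _) (sumOver-⁅⁆ i x)

  sumOver-pos : ∀ (v : Vec ℤ n) → sumOver (pos v) v ≡ + plus v
  sumOver-pos []             = refl
  sumOver-pos (+ zero ∷ v)   = trans (ℤ.+-identityˡ _) (sumOver-pos v)
  sumOver-pos (+ suc k ∷ v)  = +-congˡ (+ suc k) (sumOver-pos v)
  sumOver-pos (-[1+ _ ] ∷ v) = trans (ℤ.+-identityˡ _) (sumOver-pos v)

  sumOver-∁pos : ∀ (v : Vec ℤ n) → sumOver (∁ (pos v)) v ≡ - + minus v
  sumOver-∁pos []             = refl
  sumOver-∁pos (+ zero ∷ v)   = trans (ℤ.+-identityˡ _) (sumOver-∁pos v)
  sumOver-∁pos (+ suc k ∷ v)  = trans (ℤ.+-identityˡ _) (sumOver-∁pos v)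
  sumOver-∁pos (-[1+ k ] ∷ v) =
    trans (+-congˡ -[1+ k ] (sumOver-∁pos v)) (sym (ℤ.neg-distrib-+ (+ suc k) (+ minus v)))

  sumOver-⊤-± : ∀ (v : Vec ℤ n) → sumOver ⊤ v ≡ + plus v - + minus v
  sumOver-⊤-± v = trans (sym (sumOver-∁ (pos v) v)) (cong₂ _+_ (sumOver-pos v) (sumOver-∁pos v))

  Submodular : (Subset n → ℤ) → Set
  Submodular f = ∀ S T → f (S ∪ T) + f (S ∩ T) ≤ f S + f T

  -- Coordinate i is the marginal gain of i over {0, …, i - 1}.
  greedy : (Subset n → ℤ) → Vec ℤ n
  greedy {zero}  f = []
  greedy {suc n} f = (f (inside ∷ ⊥) - f (outside ∷ ⊥)) ∷ greedy (f ∘ (inside ∷_))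

  telescope : ∀ a b c → (b - c) + (a - b) ≡ a - c
  telescope = solve-∀

  greedy-⊤ : (f : Subset n → ℤ) → sumOver ⊤ (greedy f) ≡ f ⊤ - f ⊥
  greedy-⊤ {zero}  f = sym (ℤ.+-inverseʳ (f []))
  greedy-⊤ {suc n} f = trans (+-congˡ (f (inside ∷ ⊥) - f ⊥) (greedy-⊤ (f ∘ (inside ∷_)))) (telescope (f ⊤) (f (inside ∷ ⊥)) (f ⊥))

  -- If the first element lies in S, the marginal gains telescope as in `greedy-⊤`. Otherwise the
  -- recursion bounds the gain of S on top of the first element, and by submodularity (`exchange`)
  -- this is at most the gain of S on top of the empty set.
  greedy-≤ : (f : Subset n → ℤ) → Submodular f → ∀ S → sumOver S (greedy f) ≤ f S - f ⊥
  greedy-≤ f sub [] = ℤ.≤-reflexive (sym (ℤ.+-inverseʳ (f [])))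
  greedy-≤ f sub (inside ∷ S) = ℤ.≤-trans
    (ℤ.+-monoʳ-≤ (f (inside ∷ ⊥) - f ⊥) (greedy-≤ (f ∘ (inside ∷_)) (λ T U → sub (inside ∷ T) (inside ∷ U)) S))
    (ℤ.≤-reflexive (telescope (f (inside ∷ S)) (f (inside ∷ ⊥)) (f ⊥)))
  greedy-≤ f sub (outside ∷ S) = begin
    0ℤ + sumOver S (greedy (f ∘ (inside ∷_)))     ≡⟨ ℤ.+-identityˡ _ ⟩
    sumOver S (greedy (f ∘ (inside ∷_)))          ≤⟨ greedy-≤ (f ∘ (inside ∷_)) (λ T U → sub (inside ∷ T) (inside ∷ U)) S ⟩
    f (inside ∷ S) - f (inside ∷ ⊥)               ≡⟨ lemma (f (inside ∷ S)) (f (inside ∷ ⊥)) (f ⊥) ⟩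
    (f (inside ∷ S) + f ⊥) - (f (inside ∷ ⊥) + f ⊥) ≤⟨ ℤ.+-monoˡ-≤ (- (f (inside ∷ ⊥) + f ⊥)) (exchange S) ⟩
    (f (inside ∷ ⊥) + f (outside ∷ S)) - (f (inside ∷ ⊥) + f ⊥) ≡⟨ lemma′ (f (inside ∷ ⊥)) (f (outside ∷ S)) (f ⊥) ⟩
    f (outside ∷ S) - f ⊥                         ∎
    where
    open ℤ.≤-Reasoning
    lemma : ∀ a b c → a - b ≡ (a + c) - (b + c)
    lemma = solve-∀
    lemma′ : ∀ a b c → (a + b) - (a + c) ≡ b - c
    lemma′ = solve-∀
    exchange : ∀ S → f (inside ∷ S) + f ⊥ ≤ f (inside ∷ ⊥) + f (outside ∷ S)
    exchange S = subst₂ (λ U V → f (inside ∷ U) + f (outside ∷ V) ≤ f (inside ∷ ⊥) + f (outside ∷ S))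
      (Subset.∪-identityˡ S) (Subset.∩-zeroˡ S) (sub (inside ∷ ⊥) (outside ∷ S))

  module _ (M : Matroid n) where
    open Matroid M

    rank-⊥ : rank ⊥ ≡ 0
    rank-⊥ = ℕ.n≤0⇒n≡0 (ℕ.≤-trans (rank-≤ ⊥) (ℕ.≤-reflexive (Subset.∣⊥∣≡0 n)))

    submodularℤ : Submodular (λ S → + rank S)
    submodularℤ S T = ℤ.+≤+ (rank-submod S T)

    -- The upper bound is the rank of a singleton. For the lower bound, the sum of x over all
    -- elements but i is at most r(E), which is the sum of x over all of E.
    base-01 : ∀ x → IsBase M x → ∀ i → 0ℤ ≤ lookup x i × lookup x i ≤ 1ℤ
    base-01 x (total , bound) i = nonneg , ≤1
      where
      open ℤ.≤-Reasoning
      ≤1 : lookup x i ≤ 1ℤ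
      ≤1 = begin
        lookup x i         ≡⟨ sumOver-⁅⁆ i x ⟨
        sumOver ⁅ i ⁆ x    ≤⟨ bound ⁅ i ⁆ ⟩
        + rank ⁅ i ⁆       ≤⟨ ℤ.+≤+ (rank-≤ ⁅ i ⁆) ⟩
        + ∣ ⁅ i ⁆ ∣        ≡⟨ cong +_ (Subset.∣⁅x⁆∣≡1 i) ⟩
        1ℤ                 ∎
      nonneg : 0ℤ ≤ lookup x i
      nonneg = begin
        0ℤ                                          ≡⟨ ℤ.+-inverseʳ (+ rank ⊤) ⟨
        + rank ⊤ - + rank ⊤                         ≤⟨ ℤ.+-monoʳ-≤ (+ rank ⊤) (ℤ.neg-mono-≤ (ℤ.≤-trans (bound (∁ ⁅ i ⁆)) (ℤ.+≤+ (rank-mono (Subset.⊆-max _))))) ⟩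
        + rank ⊤ - sumOver (∁ ⁅ i ⁆) x              ≡⟨ cong (_- sumOver (∁ ⁅ i ⁆) x) (trans (sumOver-∁ ⁅ i ⁆ x) total) ⟨
        sumOver ⁅ i ⁆ x + sumOver (∁ ⁅ i ⁆) x - sumOver (∁ ⁅ i ⁆) x ≡⟨ a+b-b≡a (sumOver ⁅ i ⁆ x) (sumOver (∁ ⁅ i ⁆) x) ⟩
        sumOver ⁅ i ⁆ x                             ≡⟨ sumOver-⁅⁆ i x ⟩
        lookup x i                                  ∎

    -- The greedy base for an order that lists A before its complement: the marginal
    -- gains inside A come from S ↦ r(S ∩ A), those outside A from S ↦ r(S ∪ A).
    base-through : ∀ A → ∃[ x ] IsBase M x × + rank A ≤ sumOver A x
    base-through A = x , (total , bound) , through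
      where
      f g : Subset n → ℤ
      f S = + rank (S ∩ A)
      g S = + rank (S ∪ A)
      x = zipWith _+_ (greedy f) (greedy g)

      open CommutativeSemigroup (CommutativeMonoid.commutativeSemigroup (Subset.∩-commutativeMonoid n))
        using () renaming (interchange to ∩-interchange)
      open CommutativeSemigroup (CommutativeMonoid.commutativeSemigroup (Subset.∪-commutativeMonoid n))
        using () renaming (interchange to ∪-interchange)
      f-sub : Submodular f
      f-sub S T = subst₂ (λ U V → + rank U + + rank V ≤ f S + f T)
        (sym (Subset.∩-distribʳ-∪ A S T))
        (trans (∩-interchange S A T A) (cong ((S ∩ T) ∩_) (Subset.∩-idem A))) (submodularℤ (S ∩ A) (T ∩ A))
      g-sub : Submodular g
      g-sub S T = subst₂ (λ U V → + rank U + + rank V ≤ g S + g T)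
        (trans (∪-interchange S A T A) (cong ((S ∪ T) ∪_) (Subset.∪-idem A))) (sym (Subset.∪-distribʳ-∩ A S T)) (submodularℤ (S ∪ A) (T ∪ A))

      f⊥ : f ⊥ ≡ 0ℤ
      f⊥ = cong +_ (trans (cong rank (Subset.∩-zeroˡ A)) rank-⊥)
      g⊥ : g ⊥ ≡ + rank A
      g⊥ = cong (+_ ∘ rank) (Subset.∪-identityˡ A)
      drop⊥ : ∀ S → (f S - f ⊥) + (g S - g ⊥) ≡ (f S + g S) - + rank A
      drop⊥ S = trans (cong₂ (λ a b → (f S - a) + (g S - b)) f⊥ g⊥) (lemma (f S) (g S) (+ rank A))
        where
        lemma : ∀ a b c → (a - 0ℤ) + (b - c) ≡ (a + b) - c
        lemma = solve-∀

      open ℤ.≤-Reasoning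
      total : sumOver ⊤ x ≡ + rank ⊤
      total = begin-equality
        sumOver ⊤ x                                  ≡⟨ sumOver-+ ⊤ (greedy f) (greedy g) ⟩
        sumOver ⊤ (greedy f) + sumOver ⊤ (greedy g)  ≡⟨ cong₂ _+_ (greedy-⊤ f) (greedy-⊤ g) ⟩
        (f ⊤ - f ⊥) + (g ⊤ - g ⊥)                    ≡⟨ drop⊥ ⊤ ⟩
        (f ⊤ + g ⊤) - + rank A                       ≡⟨ cong₂ (λ U V → (+ rank U + + rank V) - + rank A) (Subset.∩-identityˡ A) (Subset.∪-zeroˡ A) ⟩
        (+ rank A + + rank ⊤) - + rank A             ≡⟨ lemma (+ rank A) (+ rank ⊤) ⟩
        + rank ⊤                                     ∎
        where
        lemma : ∀ a b → (a + b) - a ≡ b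
        lemma = solve-∀

      -- The strong form of the base inequality. Submodularity turns it into `bound`, and at the
      -- complement of A it becomes r(E) - r(A), which forces the remaining r(A) onto A in
      -- `through`.
      bound′ : ∀ S → sumOver S x ≤ (f S + g S) - + rank A
      bound′ S = begin
        sumOver S x                                  ≡⟨ sumOver-+ S (greedy f) (greedy g) ⟩
        sumOver S (greedy f) + sumOver S (greedy g)  ≤⟨ ℤ.+-mono-≤ (greedy-≤ f f-sub S) (greedy-≤ g g-sub S) ⟩
        (f S - f ⊥) + (g S - g ⊥)                    ≡⟨ drop⊥ S ⟩
        (f S + g S) - + rank A                       ∎

      bound : ∀ S → sumOver S x ≤ + rank S
      bound S = begin
        sumOver S x                    ≤⟨ bound′ S ⟩
        (f S + g S) - + rank A         ≡⟨ cong (_- + rank A) (ℤ.+-comm (f S) (g S)) ⟩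
        (g S + f S) - + rank A         ≤⟨ ℤ.+-monoˡ-≤ (- + rank A) (submodularℤ S A) ⟩
        (+ rank S + + rank A) - + rank A ≡⟨ a+b-b≡a (+ rank S) (+ rank A) ⟩
        + rank S                       ∎

      through : + rank A ≤ sumOver A x
      through = begin
        + rank A                                       ≡⟨ lemma (+ rank ⊤) (+ rank A) ⟨
        + rank ⊤ - ((0ℤ + + rank ⊤) - + rank A)        ≡⟨ cong₂ (λ a U → + rank ⊤ - ((a + + rank U) - + rank A)) (cong +_ (trans (cong rank (Subset.∩-inverseˡ A)) rank-⊥)) (Subset.∪-inverseˡ A) ⟨
        + rank ⊤ - ((f (∁ A) + g (∁ A)) - + rank A)    ≤⟨ ℤ.+-monoʳ-≤ (+ rank ⊤) (ℤ.neg-mono-≤ (bound′ (∁ A))) ⟩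
        + rank ⊤ - sumOver (∁ A) x                     ≡⟨ cong (_- sumOver (∁ A) x) (trans (sumOver-∁ A x) total) ⟨
        sumOver A x + sumOver (∁ A) x - sumOver (∁ A) x ≡⟨ a+b-b≡a (sumOver A x) (sumOver (∁ A) x) ⟩
        sumOver A x                                    ∎
        where
        lemma : ∀ a b → a - ((0ℤ + a) - b) ≡ b
        lemma = solve-∀

-- Linear functionals on convex hulls, and the inequalities that every lattice point satisfies.

module Polytopes where
  open ≡
  open import Data.Rational.Base using (_+_; _*_; -_; _≤_; toℚᵘ)

  private
    variable
      n : ℕ

  open CommutativeSemigroup (CommutativeMonoid.commutativeSemigroup ℚ.+-0-commutativeMonoid)
    using () renaming (interchange to +ℚ-interchange)

  +ℚ-congˡ : ∀ a {b c} → b ≡ c → a + b ≡ a + c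
  +ℚ-congˡ a = cong (λ b → a + b)

  ι : ℤ → ℚ
  ι z = z ℚ./ 1

  toℚᵘ-ι : ∀ z → toℚᵘ (ι z) ℚᵘ.≃ ℚᵘ.mkℚᵘ z 0
  toℚᵘ-ι z = ℚ.toℚᵘ-fromℚᵘ (ℚᵘ.mkℚᵘ z 0)

  ι-+ : ∀ a b → ι (a ℤ.+ b) ≡ ι a + ι b
  ι-+ a b = ℚ.toℚᵘ-injective (begin
    toℚᵘ (ι (a ℤ.+ b))                  ≈⟨ toℚᵘ-ι (a ℤ.+ b) ⟩
    ℚᵘ.mkℚᵘ (a ℤ.+ b) 0                 ≈⟨ ℚᵘ.*≡* (cong (ℤ._* ℤ.1ℤ) (sym (cong₂ ℤ._+_ (ℤ.*-identityʳ a) (ℤ.*-identityʳ b)))) ⟩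
    ℚᵘ.mkℚᵘ a 0 ℚᵘ.+ ℚᵘ.mkℚᵘ b 0        ≈⟨ ℚᵘ.+-cong (toℚᵘ-ι a) (toℚᵘ-ι b) ⟨
    toℚᵘ (ι a) ℚᵘ.+ toℚᵘ (ι b)          ≈⟨ ℚ.toℚᵘ-homo-+ (ι a) (ι b) ⟨
    toℚᵘ (ι a + ι b)                    ∎)
    where open ℚᵘ.≃-Reasoning

  ι-neg : ∀ a → ι (ℤ.- a) ≡ - ι a
  ι-neg a = ℚ.toℚᵘ-injective (begin
    toℚᵘ (ι (ℤ.- a))          ≈⟨ toℚᵘ-ι (ℤ.- a) ⟩
    ℚᵘ.- ℚᵘ.mkℚᵘ a 0          ≈⟨ ℚᵘ.-‿cong (toℚᵘ-ι a) ⟨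
    ℚᵘ.- toℚᵘ (ι a)           ≈⟨ ℚ.toℚᵘ-homo‿- (ι a) ⟨
    toℚᵘ (- ι a)              ∎)
    where open ℚᵘ.≃-Reasoning

  ι-mono-≤ : ∀ {a b} → a ℤ.≤ b → ι a ≤ ι b
  ι-mono-≤ {a} {b} a≤b = ℚ.toℚᵘ-cancel-≤ (begin
    toℚᵘ (ι a)       ≃⟨ toℚᵘ-ι a ⟩
    ℚᵘ.mkℚᵘ a 0      ≤⟨ ℚᵘ.*≤* (ℤ.*-monoʳ-≤-nonNeg ℤ.1ℤ a≤b) ⟩
    ℚᵘ.mkℚᵘ b 0      ≃⟨ toℚᵘ-ι b ⟨
    toℚᵘ (ι b)       ∎)
    where open ℚᵘ.≤-Reasoning

  ι-cancel-≤ : ∀ {a b} → ι a ≤ ι b → a ℤ.≤ b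
  ι-cancel-≤ {a} {b} ιa≤ιb with ℚᵘ.*≤* a*1≤b*1 ←
      ℚᵘ.≤-respʳ-≃ (toℚᵘ-ι b) (ℚᵘ.≤-respˡ-≃ (toℚᵘ-ι a) (ℚ.toℚᵘ-mono-≤ ιa≤ιb)) =
    subst₂ ℤ._≤_ (ℤ.*-identityʳ a) (ℤ.*-identityʳ b) a*1≤b*1

  ι-injective : ∀ {a b} → ι a ≡ ι b → a ≡ b
  ι-injective eq = ℤ.≤-antisym (ι-cancel-≤ (ℚ.≤-reflexive eq)) (ι-cancel-≤ (ℚ.≤-reflexive (sym eq)))

  record Linear (f : Vec ℚ n → ℚ) : Set where
    field
      homo-0 : f 0ᵛ ≡ 0ℚ
      homo-+ : ∀ v w → f (v +ᵛ w) ≡ f v + f w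
      homo-* : ∀ a v → f (a *ᵛ v) ≡ a * f v

  -- The relation is a parameter so that one induction over a convex combination transfers upper
  -- bounds, lower bounds and equalities from the generators to the hull.
  module Convex (_∼_ : Rel ℚ 0ℓ) (∼-refl : ∀ {a} → a ∼ a)
                (+-mono : ∀ {a b c d} → a ∼ b → c ∼ d → (a + c) ∼ (b + d))
                (*-mono : ∀ {w a b} → 0ℚ ≤ w → a ∼ b → (w * a) ∼ (w * b)) where

    conv-∼ : ∀ {ℓ} {A : Pred (Vec ℚ n) ℓ} {f} {c} → Linear f → (∀ v → A v → f v ∼ c) →
             ∀ {p} → conv A p → f p ∼ c
    conv-∼ {A = A} {f} {c} lin A∼c (ws , ws∈ , sum≡1 , refl) =
      subst (f (combination ws) ∼_) (trans (cong (_* c) sum≡1) (ℚ.*-identityˡ c)) (go ws ws∈)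
      where
      open Linear lin
      combination = λ ws → List.foldr _+ᵛ_ 0ᵛ (List.map (λ (a , v) → a *ᵛ v) ws)
      go : ∀ ws → All (λ w → 0ℚ ≤ proj₁ w × A (proj₂ w)) ws →
           f (combination ws) ∼ (List.foldr _+_ 0ℚ (List.map proj₁ ws) * c)
      go [] [] = subst₂ _∼_ (sym homo-0) (sym (ℚ.*-zeroˡ c)) ∼-refl
      go ((a , v) ∷ ws) ((0≤a , v∈) ∷ ws∈) = subst₂ _∼_
        (sym (trans (homo-+ (a *ᵛ v) _) (cong (λ b → b + _) (homo-* a v))))
        (sym (ℚ.*-distribʳ-+ c a _))
        (+-mono (*-mono 0≤a (A∼c v v∈)) (go ws ws∈))

  *-mono-≤ : ∀ {w a b} → 0ℚ ≤ w → a ≤ b → w * a ≤ w * b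
  *-mono-≤ {w} 0≤w = ℚ.*-monoˡ-≤-nonNeg w {{ℚ.nonNegative 0≤w}}

  open Convex _≤_ ℚ.≤-refl ℚ.+-mono-≤ *-mono-≤ renaming (conv-∼ to conv-≤)
  open Convex ℚ._≥_ ℚ.≤-refl ℚ.+-mono-≤ *-mono-≤ renaming (conv-∼ to conv-≥)
  open Convex _≡_ refl (cong₂ _+_) (λ {w} _ → cong (w *_)) renaming (conv-∼ to conv-≡)

  sumOverℚ : Subset n → Vec ℚ n → ℚ
  sumOverℚ []      []      = 0ℚ
  sumOverℚ (s ∷ S) (a ∷ v) = (if s then a else 0ℚ) + sumOverℚ S v

  sumOverℚ-linear : (S : Subset n) → Linear (sumOverℚ S)
  sumOverℚ-linear S = record { homo-0 = homo-0 S ; homo-+ = homo-+ S ; homo-* = λ a → homo-* a S }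
    where
    homo-0 : (S : Subset n) → sumOverℚ S 0ᵛ ≡ 0ℚ
    homo-0 []            = refl
    homo-0 (outside ∷ S) = trans (ℚ.+-identityˡ _) (homo-0 S)
    homo-0 (inside ∷ S)  = trans (ℚ.+-identityˡ _) (homo-0 S)
    homo-+ : ∀ (S : Subset n) v w → sumOverℚ S (v +ᵛ w) ≡ sumOverℚ S v + sumOverℚ S w
    homo-+ []            []      []      = refl
    homo-+ (outside ∷ S) (_ ∷ v) (_ ∷ w) = trans (+ℚ-congˡ 0ℚ (homo-+ S v w)) (+ℚ-interchange 0ℚ 0ℚ (sumOverℚ S v) (sumOverℚ S w))
    homo-+ (inside ∷ S)  (a ∷ v) (b ∷ w) = trans (+ℚ-congˡ (a + b) (homo-+ S v w)) (+ℚ-interchange a b _ _)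
    homo-* : ∀ a (S : Subset n) v → sumOverℚ S (a *ᵛ v) ≡ a * sumOverℚ S v
    homo-* a []            []      = sym (ℚ.*-zeroʳ a)
    homo-* a (outside ∷ S) (_ ∷ v) =
      trans (cong₂ _+_ (sym (ℚ.*-zeroʳ a)) (homo-* a S v)) (sym (ℚ.*-distribˡ-+ a 0ℚ _))
    homo-* a (inside ∷ S)  (b ∷ v) =
      trans (+ℚ-congˡ (a * b) (homo-* a S v)) (sym (ℚ.*-distribˡ-+ a b _))

  sumOverℚ-neg : ∀ (S : Subset n) v → sumOverℚ S (-ᵛ v) ≡ - sumOverℚ S v
  sumOverℚ-neg []            []      = refl
  sumOverℚ-neg (outside ∷ S) (_ ∷ v) =
    trans (+ℚ-congˡ 0ℚ (sumOverℚ-neg S v)) (sym (ℚ.neg-distrib-+ 0ℚ (sumOverℚ S v)))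
  sumOverℚ-neg (inside ∷ S)  (a ∷ v) =
    trans (+ℚ-congˡ (- a) (sumOverℚ-neg S v)) (sym (ℚ.neg-distrib-+ a (sumOverℚ S v)))

  sumOverℚ-ι : ∀ (S : Subset n) x → sumOverℚ S (ℤ→ℚ x) ≡ ι (sumOver S x)
  sumOverℚ-ι []            []      = refl
  sumOverℚ-ι (outside ∷ S) (_ ∷ x) = trans (+ℚ-congˡ 0ℚ (sumOverℚ-ι S x)) (sym (ι-+ ℤ.0ℤ (sumOver S x)))
  sumOverℚ-ι (inside ∷ S)  (a ∷ x) = trans (+ℚ-congˡ (ι a) (sumOverℚ-ι S x)) (sym (ι-+ a (sumOver S x)))

  module _ where
    open Linear

    sumOverℚ-e-≥ : ∀ (S : Subset n) i → 0ℚ ≤ sumOverℚ S (e i)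
    sumOverℚ-e-≥ (inside ∷ S)  zero    =
      ℚ.≤-trans (ℚ.nonNegative⁻¹ 1ℚ) (ℚ.≤-reflexive (sym (trans (+ℚ-congˡ 1ℚ (homo-0 (sumOverℚ-linear S))) (ℚ.+-identityʳ 1ℚ))))
    sumOverℚ-e-≥ (outside ∷ S) zero    = ℚ.≤-reflexive (sym (homo-0 (sumOverℚ-linear (outside ∷ S))))
    sumOverℚ-e-≥ (inside ∷ S)  (suc i) = ℚ.≤-trans (sumOverℚ-e-≥ S i) (ℚ.≤-reflexive (sym (ℚ.+-identityˡ _)))
    sumOverℚ-e-≥ (outside ∷ S) (suc i) = ℚ.≤-trans (sumOverℚ-e-≥ S i) (ℚ.≤-reflexive (sym (ℚ.+-identityˡ _)))

    sumOverℚ-e-≤ : ∀ (S : Subset n) i → sumOverℚ S (e i) ≤ 1ℚ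
    sumOverℚ-e-≤ (inside ∷ S)  zero    =
      ℚ.≤-reflexive (trans (+ℚ-congˡ 1ℚ (homo-0 (sumOverℚ-linear S))) (ℚ.+-identityʳ 1ℚ))
    sumOverℚ-e-≤ (outside ∷ S) zero    =
      ℚ.≤-trans (ℚ.≤-reflexive (homo-0 (sumOverℚ-linear (outside ∷ S)))) (ℚ.nonNegative⁻¹ 1ℚ)
    sumOverℚ-e-≤ (inside ∷ S)  (suc i) = ℚ.≤-trans (ℚ.≤-reflexive (ℚ.+-identityˡ _)) (sumOverℚ-e-≤ S i)
    sumOverℚ-e-≤ (outside ∷ S) (suc i) = ℚ.≤-trans (ℚ.≤-reflexive (ℚ.+-identityˡ _)) (sumOverℚ-e-≤ S i)

    sumOverℚ-⊤-e : ∀ (i : Fin n) → sumOverℚ ⊤ (e i) ≡ 1ℚ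
    sumOverℚ-⊤-e {suc n} zero = trans (+ℚ-congˡ 1ℚ (homo-0 (sumOverℚ-linear {n} ⊤))) (ℚ.+-identityʳ 1ℚ)
    sumOverℚ-⊤-e (suc i) = trans (ℚ.+-identityˡ _) (sumOverℚ-⊤-e i)

  module _ (M : Matroid n) where
    open Matroid M
    open ℚ.≤-Reasoning

    private
      ιℕ : ℕ → ℚ
      ιℕ k = ι (+ k)

      0≤ιℕ : ∀ k → 0ℚ ≤ ιℕ k
      0≤ιℕ k = ι-mono-≤ {ℤ.0ℤ} {+ k} (ℤ.+≤+ ℕ.z≤n)

      sum-split : ∀ (S : Subset n) {t u p d d′} → sumOverℚ S (p +ᵛ (ιℕ u *ᵛ d) +ᵛ (ιℕ t *ᵛ (-ᵛ d′))) ≡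
                  sumOverℚ S p + ιℕ u * sumOverℚ S d + ιℕ t * - sumOverℚ S d′
      sum-split S {t} {u} {p} {d} {d′} = begin-equality
        sumOverℚ S (p +ᵛ (ιℕ u *ᵛ d) +ᵛ (ιℕ t *ᵛ (-ᵛ d′)))
          ≡⟨ homo-+ _ _ ⟩
        sumOverℚ S (p +ᵛ (ιℕ u *ᵛ d)) + sumOverℚ S (ιℕ t *ᵛ (-ᵛ d′))
          ≡⟨ cong₂ _+_ (homo-+ _ _) (trans (homo-* (ιℕ t) (-ᵛ d′)) (cong (ιℕ t *_) (sumOverℚ-neg S d′))) ⟩
        sumOverℚ S p + sumOverℚ S (ιℕ u *ᵛ d) + ιℕ t * - sumOverℚ S d′
          ≡⟨ cong (λ a → sumOverℚ S p + a + ιℕ t * - sumOverℚ S d′) (homo-* (ιℕ u) d) ⟩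
        sumOverℚ S p + ιℕ u * sumOverℚ S d + ιℕ t * - sumOverℚ S d′
          ∎
        where open Linear (sumOverℚ-linear S)

    -- The sum of all coordinates is constant on each Minkowski summand: r(E) on the base polytope,
    -- 1 on Δ and -1 on ∇.
    lattice-⊤ : ∀ {t u q} → LatticePoint M t u q → sumOver ⊤ q ≡ + rank ⊤ ℤ.+ + u ℤ.- + t
    lattice-⊤ {t} {u} {q} (_ , _ , (p , _ , p∈ , (d , d∈ , refl) , refl) , (_ , (d′ , d′∈ , refl) , refl) , eq) =
      ι-injective (begin-equality
        ι (sumOver ⊤ q)                           ≡⟨ sumOverℚ-ι ⊤ q ⟨
        sumOverℚ ⊤ (ℤ→ℚ q)                        ≡⟨ cong (sumOverℚ ⊤) eq ⟩
        sumOverℚ ⊤ (p +ᵛ (ιℕ u *ᵛ d) +ᵛ (ιℕ t *ᵛ (-ᵛ d′))) ≡⟨ sum-split ⊤ {t} {u} {p} {d} {d′} ⟩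
        sumOverℚ ⊤ p + ιℕ u * sumOverℚ ⊤ d + ιℕ t * - sumOverℚ ⊤ d′
          ≡⟨ cong₂ (λ a b → a + ιℕ u * b + ιℕ t * - sumOverℚ ⊤ d′) (conv-≡ lin base p∈) (Δ-sum d∈) ⟩
        ιℕ (rank ⊤) + ιℕ u * 1ℚ + ιℕ t * - sumOverℚ ⊤ d′
          ≡⟨ cong₂ (λ a b → ιℕ (rank ⊤) + a + ιℕ t * - b) (ℚ.*-identityʳ _) (Δ-sum d′∈) ⟩
        ιℕ (rank ⊤) + ιℕ u + ιℕ t * - 1ℚ
          ≡⟨ cong₂ _+_ (ι-+ (+ rank ⊤) (+ u)) (trans (cong -_ (sym (ℚ.*-identityʳ (ιℕ t)))) (ℚ.neg-distribʳ-* (ιℕ t) 1ℚ)) ⟨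
        ι (+ rank ⊤ ℤ.+ + u) + - ιℕ t
          ≡⟨ +ℚ-congˡ (ι (+ rank ⊤ ℤ.+ + u)) (ι-neg (+ t)) ⟨
        ι (+ rank ⊤ ℤ.+ + u) + ι (ℤ.- + t)        ≡⟨ ι-+ (+ rank ⊤ ℤ.+ + u) (ℤ.- + t) ⟨
        ι (+ rank ⊤ ℤ.+ + u ℤ.- + t)              ∎)
      where
      lin = sumOverℚ-linear ⊤
      base : ∀ v → ∃[ x ] IsBase M x × v ≡ ℤ→ℚ x → sumOverℚ ⊤ v ≡ ιℕ (rank ⊤)
      base _ (x , (total , _) , refl) = trans (sumOverℚ-ι ⊤ x) (cong ι total)
      Δ-sum : ∀ {d} → Δ d → sumOverℚ ⊤ d ≡ 1ℚ
      Δ-sum = conv-≡ lin (λ { _ (i , refl) → sumOverℚ-⊤-e i })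

    -- Over S, a base sums to at most r(S), a point of Δ to at most 1, and a point of ∇ to at most
    -- 0, so the t copies of ∇ drop out.
    lattice-≤ : ∀ {t u q} → LatticePoint M t u q → ∀ S → sumOver S q ℤ.≤ + rank S ℤ.+ + u
    lattice-≤ {t} {u} {q} (_ , _ , (p , _ , p∈ , (d , d∈ , refl) , refl) , (_ , (d′ , d′∈ , refl) , refl) , eq) S =
      ι-cancel-≤ (begin
        ι (sumOver S q)                           ≡⟨ sumOverℚ-ι S q ⟨
        sumOverℚ S (ℤ→ℚ q)                        ≡⟨ cong (sumOverℚ S) eq ⟩
        sumOverℚ S (p +ᵛ (ιℕ u *ᵛ d) +ᵛ (ιℕ t *ᵛ (-ᵛ d′))) ≡⟨ sum-split S {t} {u} {p} {d} {d′} ⟩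
        sumOverℚ S p + ιℕ u * sumOverℚ S d + ιℕ t * - sumOverℚ S d′
          ≤⟨ ℚ.+-mono-≤
               (ℚ.+-mono-≤ (conv-≤ lin base p∈) (*-mono-≤ (0≤ιℕ u) (conv-≤ lin (λ { _ (i , refl) → sumOverℚ-e-≤ S i }) d∈)))
               (*-mono-≤ (0≤ιℕ t) (ℚ.neg-antimono-≤ (conv-≥ lin (λ { _ (i , refl) → sumOverℚ-e-≥ S i }) d′∈))) ⟩
        ιℕ (rank S) + ιℕ u * 1ℚ + ιℕ t * 0ℚ
          ≡⟨ cong₂ (λ a b → ιℕ (rank S) + a + b) (ℚ.*-identityʳ _) (ℚ.*-zeroʳ (ιℕ t)) ⟩
        ιℕ (rank S) + ιℕ u + 0ℚ                   ≡⟨ ℚ.+-identityʳ _ ⟩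
        ιℕ (rank S) + ιℕ u                        ≡⟨ ι-+ (+ rank S) (+ u) ⟨
        ι (+ rank S ℤ.+ + u)                      ∎)
      where
      lin = sumOverℚ-linear S
      base : ∀ v → ∃[ x ] IsBase M x × v ≡ ℤ→ℚ x → sumOverℚ S v ≤ ιℕ (rank S)
      base _ (x , (_ , bound) , refl) = ℚ.≤-trans (ℚ.≤-reflexive (sumOverℚ-ι S x)) (ι-mono-≤ (bound S))

-- Writing an integer vector as a base plus a point of uΔ plus a point of t∇.

module Decomposition where
  open ≡
  open import Data.Nat.Base using (_∸_)
  open import Data.Vec.Base using (zipWith)
  open ℤ-Solver using (solve-∀)
  open Orthants
  open Bases
  open Polytopes

  private
    variable
      n : ℕ

  combination : List (ℚ × Vec ℚ n) → Vec ℚ n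
  combination ws = List.foldr _+ᵛ_ 0ᵛ (List.map (λ (a , v) → a *ᵛ v) ws)

  vertices : Vec ℚ n → List (ℚ × Vec ℚ n)
  vertices []      = []
  vertices (a ∷ d) = (a , e zero) ∷ List.map (map₂ (0ℚ ∷_)) (vertices d)

  *ᵛ-zeroʳ : ∀ a → a *ᵛ 0ᵛ {n} ≡ 0ᵛ
  *ᵛ-zeroʳ {zero}  a = refl
  *ᵛ-zeroʳ {suc n} a = cong₂ _∷_ (ℚ.*-zeroʳ a) (*ᵛ-zeroʳ a)

  *ᵛ-identityˡ : ∀ (v : Vec ℚ n) → 1ℚ *ᵛ v ≡ v
  *ᵛ-identityˡ []      = refl
  *ᵛ-identityˡ (a ∷ v) = cong₂ _∷_ (ℚ.*-identityˡ a) (*ᵛ-identityˡ v)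

  +ᵛ-identityˡ : ∀ (v : Vec ℚ n) → 0ᵛ +ᵛ v ≡ v
  +ᵛ-identityˡ []      = refl
  +ᵛ-identityˡ (a ∷ v) = cong₂ _∷_ (ℚ.+-identityˡ a) (+ᵛ-identityˡ v)

  +ᵛ-identityʳ : ∀ (v : Vec ℚ n) → v +ᵛ 0ᵛ ≡ v
  +ᵛ-identityʳ = zipWith-identityʳ ℚ.+-identityʳ

  combination-lift : ∀ (ws : List (ℚ × Vec ℚ n)) → combination (List.map (map₂ (0ℚ ∷_)) ws) ≡ 0ℚ ∷ combination ws
  combination-lift [] = refl
  combination-lift ((a , v) ∷ ws) = trans (cong (((a ℚ.* 0ℚ) ∷ (a *ᵛ v)) +ᵛ_) (combination-lift ws))
    (cong (_∷ ((a *ᵛ v) +ᵛ combination ws)) (trans (ℚ.+-identityʳ (a ℚ.* 0ℚ)) (ℚ.*-zeroʳ a)))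

  combination-vertices : ∀ (d : Vec ℚ n) → combination (vertices d) ≡ d
  combination-vertices []      = refl
  combination-vertices (a ∷ d) = trans
    (cong (((a ℚ.* 1ℚ) ∷ (a *ᵛ 0ᵛ)) +ᵛ_) (trans (combination-lift (vertices d)) (cong (0ℚ ∷_) (combination-vertices d))))
    (cong₂ _∷_ (trans (ℚ.+-identityʳ (a ℚ.* 1ℚ)) (ℚ.*-identityʳ a))
               (trans (cong (_+ᵛ d) (*ᵛ-zeroʳ a)) (+ᵛ-identityˡ d)))

  weights-vertices : ∀ (d : Vec ℚ n) → List.foldr ℚ._+_ 0ℚ (List.map proj₁ (vertices d)) ≡ sumOverℚ ⊤ d
  weights-vertices []      = refl
  weights-vertices (a ∷ d) = +ℚ-congˡ a (trans
    (cong (List.foldr ℚ._+_ 0ℚ) (sym (List.map-∘ (vertices d)))) (weights-vertices d))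

  simplex : ∀ {d : Vec ℚ n} → VecAll.All (0ℚ ℚ.≤_) d → sumOverℚ ⊤ d ≡ 1ℚ → Δ d
  simplex {d = d} 0≤d sum≡1 =
    vertices d , vertices∈ d 0≤d , trans (weights-vertices d) sum≡1 , combination-vertices d
    where
    vertices∈ : ∀ (d : Vec ℚ n) → VecAll.All (0ℚ ℚ.≤_) d →
                All (λ w → 0ℚ ℚ.≤ proj₁ w × ∃[ i ] proj₂ w ≡ e i) (vertices d)
    vertices∈ []      []          = []
    vertices∈ (a ∷ d) (0≤a ∷ 0≤d) = (0≤a , zero , refl) ∷
      All.map⁺ (All.map (λ (0≤w , i , eq) → 0≤w , suc i , cong (0ℚ ∷_) eq) (vertices∈ d 0≤d))

  sumOver-+ℕ : ∀ (k : Vec ℕ n) → sumOver ⊤ (Vec.map +_ k) ≡ + Vec.sum k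
  sumOver-+ℕ []      = refl
  sumOver-+ℕ (a ∷ k) = +-congˡ (+ a) (sumOver-+ℕ k)

  dilated-simplex : ∀ (k : Vec ℕ (suc n)) s → Vec.sum k ≡ s →
                    ∃[ d ] Δ d × ℤ→ℚ (Vec.map +_ k) ≡ ι (+ s) *ᵛ d
  -- Here `k` vanishes and cannot be divided by its sum. Any point of Δ serves, and the first unit
  -- vector exists because there is at least one coordinate.
  dilated-simplex {n} k zero sum≡0 = e zero , simplex 0≤e (sumOverℚ-⊤-e {suc n} zero) , vanish k (e zero) sum≡0
    where
    0≤0ᵛ : ∀ n → VecAll.All (0ℚ ℚ.≤_) (0ᵛ {n})
    0≤0ᵛ zero    = []
    0≤0ᵛ (suc n) = ℚ.≤-refl ∷ 0≤0ᵛ n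
    0≤e : VecAll.All (0ℚ ℚ.≤_) (e {suc n} zero)
    0≤e = ℚ.nonNegative⁻¹ 1ℚ ∷ 0≤0ᵛ n
    vanish : ∀ {n} (k : Vec ℕ n) v → Vec.sum k ≡ 0 → ℤ→ℚ (Vec.map +_ k) ≡ 0ℚ *ᵛ v
    vanish []         []      _     = refl
    vanish (zero ∷ k) (a ∷ v) sum≡0 = cong₂ _∷_ (sym (ℚ.*-zeroˡ a)) (vanish k v sum≡0)
  dilated-simplex {n} k s@(suc _) sum≡s =
    inv *ᵛ kℚ , simplex (nonneg k) sum≡1 , sym (rescale kℚ)
    where
    kℚ = ℤ→ℚ (Vec.map +_ k)
    instance
      s>0 : ℚ.Positive (ι (+ s))
      s>0 = ℚ.normalize-pos s 1
      s≢0 : ℚ.NonZero (ι (+ s))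
      s≢0 = ℚ.pos⇒nonZero (ι (+ s))
    inv = ℚ.1/ ι (+ s)
    0≤inv : 0ℚ ℚ.≤ inv
    0≤inv = ℚ.nonNegative⁻¹ inv {{ℚ.pos⇒nonNeg inv {{ℚ.1/pos⇒pos (ι (+ s))}}}}
    nonneg : ∀ {n} (k : Vec ℕ n) → VecAll.All (0ℚ ℚ.≤_) (inv *ᵛ ℤ→ℚ (Vec.map +_ k))
    nonneg []      = []
    nonneg (a ∷ k) =
      ℚ.≤-trans (ℚ.≤-reflexive (sym (ℚ.*-zeroʳ inv))) (*-mono-≤ 0≤inv (ι-mono-≤ {ℤ.0ℤ} {+ a} (ℤ.+≤+ ℕ.z≤n)))
      ∷ nonneg k
    sum≡1 : sumOverℚ ⊤ (inv *ᵛ kℚ) ≡ 1ℚ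
    sum≡1 = begin
      sumOverℚ ⊤ (inv *ᵛ kℚ)                     ≡⟨ Linear.homo-* (sumOverℚ-linear (⊤ {suc n})) inv kℚ ⟩
      inv ℚ.* sumOverℚ ⊤ kℚ                      ≡⟨ cong (inv ℚ.*_) (sumOverℚ-ι ⊤ (Vec.map +_ k)) ⟩
      inv ℚ.* ι (sumOver ⊤ (Vec.map +_ k))       ≡⟨ cong (λ z → inv ℚ.* ι z) (trans (sumOver-+ℕ k) (cong +_ sum≡s)) ⟩
      inv ℚ.* ι (+ s)                            ≡⟨ ℚ.*-inverseˡ (ι (+ s)) ⟩
      1ℚ                                         ∎
      where open ≡-Reasoning
    rescale : ∀ {n} (v : Vec ℚ n) → ι (+ s) *ᵛ (inv *ᵛ v) ≡ v
    rescale []      = refl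
    rescale (a ∷ v) = cong₂ _∷_
      (trans (sym (ℚ.*-assoc (ι (+ s)) inv a))
        (trans (cong (ℚ._* a) (ℚ.*-inverseʳ (ι (+ s)))) (ℚ.*-identityˡ a)))
      (rescale v)

  -- Coordinatewise, with y in {0, 1}: if z ≥ 1 then z - y ≥ 0 is its own positive part, and if z ≤
  -- 0 then z - y ≤ 0 has positive part 0.
  excess-bound : ∀ {n} (q x : Vec ℤ n) → VecAll.All (λ y → ℤ.0ℤ ℤ.≤ y × y ℤ.≤ ℤ.1ℤ) x →
                 + plus (zipWith ℤ._-_ q x) ℤ.≤ sumOver (pos q) (zipWith ℤ._-_ q x)
  excess-bound []      []      []          = ℤ.≤-refl
  excess-bound (z ∷ q) (y ∷ x) (01y ∷ 01x) = ℤ.+-mono-≤ (coordinate z y 01y) (excess-bound q x 01x)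
    where
    coordinate : ∀ z y → ℤ.0ℤ ℤ.≤ y × y ℤ.≤ ℤ.1ℤ →
                 + posPart (z ℤ.- y) ℤ.≤ (if isPos z then z ℤ.- y else ℤ.0ℤ)
    coordinate (+ zero)  (+ zero)        _ = ℤ.≤-refl
    coordinate (+ zero)  (+ suc zero)    _ = ℤ.≤-refl
    coordinate (+ suc k) (+ zero)        _ = ℤ.≤-refl
    coordinate (+ suc k) (+ suc zero)    _ = ℤ.≤-refl
    coordinate -[1+ k ]  (+ zero)        _ = ℤ.≤-refl
    coordinate -[1+ k ]  (+ suc zero)    _ = ℤ.≤-refl
    coordinate _         (+ suc (suc _)) (_ , ℤ.+≤+ (ℕ.s≤s ()))

  module _ {m : ℕ} (M : Matroid (suc m)) where
    open Matroid M

    lattice-sum : ∀ {t u} x (a b : Vec ℕ (suc m)) → IsBase M x → Vec.sum a ≡ u → Vec.sum b ≡ t →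
                  LatticePoint M t u (zipWith ℤ._-_ (zipWith ℤ._+_ x (Vec.map +_ a)) (Vec.map +_ b))
    lattice-sum {t} {u} x a b base a≡u b≡t
      with d , d∈ , a≡ud ← dilated-simplex a u a≡u
         | d′ , d′∈ , b≡td′ ← dilated-simplex b t b≡t =
      ℤ→ℚ x +ᵛ (ι (+ u) *ᵛ d) , ι (+ t) *ᵛ (-ᵛ d′) ,
      (ℤ→ℚ x , ι (+ u) *ᵛ d , x∈ , (d , d∈ , refl) , refl) ,
      (-ᵛ d′ , (d′ , d′∈ , refl) , refl) ,
      trans (split x a b) (cong₂ (λ v w → ℤ→ℚ x +ᵛ v +ᵛ w) a≡ud (trans (cong -ᵛ_ b≡td′) (neg-out (ι (+ t)) d′)))
      where
      x∈ : basePolytope M (ℤ→ℚ x)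
      x∈ = (1ℚ , ℤ→ℚ x) ∷ [] , (ℚ.nonNegative⁻¹ 1ℚ , x , base , refl) ∷ [] , refl ,
        trans (+ᵛ-identityʳ _) (*ᵛ-identityˡ (ℤ→ℚ x))
      split : ∀ {n} x (a b : Vec ℕ n) →
              ℤ→ℚ (zipWith ℤ._-_ (zipWith ℤ._+_ x (Vec.map +_ a)) (Vec.map +_ b)) ≡
              ℤ→ℚ x +ᵛ ℤ→ℚ (Vec.map +_ a) +ᵛ (-ᵛ ℤ→ℚ (Vec.map +_ b))
      split []      []      []      = refl
      split (y ∷ x) (j ∷ a) (k ∷ b) = cong₂ _∷_
        (trans (ι-+ (y ℤ.+ + j) (ℤ.- + k)) (cong₂ ℚ._+_ (ι-+ y (+ j)) (ι-neg (+ k)))) (split x a b)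
      neg-out : ∀ {n} c (v : Vec ℚ n) → -ᵛ (c *ᵛ v) ≡ c *ᵛ (-ᵛ v)
      neg-out c []      = refl
      neg-out c (a ∷ v) = cong₂ _∷_ (ℚ.neg-distribʳ-* c a) (neg-out c v)

    -- q = x + (q - x)⁺ - (q - x)⁻ for a base x through pos q. The first part has sum at
    -- most u, and the slack w is added to both parts in the first coordinate.
    lattice-intro : ∀ {t u q} → sumOver ⊤ q ≡ + rank ⊤ ℤ.+ + u ℤ.- + t →
                    sumOver (pos q) q ℤ.≤ + rank (pos q) ℤ.+ + u → LatticePoint M t u q
    lattice-intro {t} {u} {q} total bound
      with x , base , through ← base-through M (pos q) =
      subst (LatticePoint M t u) (reassemble q x) (lattice-sum x a b base sum-a sum-b)
      where
      c = zipWith ℤ._-_ q x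
      w = u ∸ plus c
      a = mapHead (ℕ._+ w) (Vec.map posPart c)
      b = mapHead (ℕ._+ w) (Vec.map negPart c)

      sum-mapHead : ∀ {n} (k : Vec ℕ (suc n)) → Vec.sum (mapHead (ℕ._+ w) k) ≡ Vec.sum k ℕ.+ w
      sum-mapHead (j ∷ k) = trans (ℕ.+-assoc j w (Vec.sum k))
        (trans (cong (j ℕ.+_) (ℕ.+-comm w (Vec.sum k))) (sym (ℕ.+-assoc j (Vec.sum k) w)))

      -- Over the positive set of q, the vector q has sum at most r + u, and x has sum at least r by
      -- the choice of the base.
      plus≤u : plus c ℕ.≤ u
      plus≤u = ℤ.drop‿+≤+ (begin
        + plus c                                     ≤⟨ excess-bound q x (VecAll.lookup⁻ (base-01 M x base)) ⟩
        sumOver (pos q) c                            ≡⟨ sumOver-minus (pos q) q x ⟩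
        sumOver (pos q) q ℤ.- sumOver (pos q) x      ≤⟨ ℤ.+-mono-≤ bound (ℤ.neg-mono-≤ through) ⟩
        + rank (pos q) ℤ.+ + u ℤ.- + rank (pos q)    ≡⟨ lemma (+ rank (pos q)) (+ u) ⟩
        + u                                          ∎)
        where
        open ℤ.≤-Reasoning
        lemma : ∀ a b → a ℤ.+ b ℤ.- a ≡ b
        lemma = solve-∀

      -- Both q and x have known totals, so the positive part of q - x falls short of u by as much
      -- as the negative part falls short of t. Hence the single slack `w` completes both.
      balance : plus c ℕ.+ t ≡ u ℕ.+ minus c
      balance = ℤ.+-injective (begin
        + plus c ℤ.+ + t                             ≡⟨ lemma (+ plus c) (+ minus c) (+ t) ⟩
        (+ plus c ℤ.+ ℤ.- + minus c) ℤ.+ (+ minus c ℤ.+ + t)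
          ≡⟨ cong (ℤ._+ (+ minus c ℤ.+ + t)) sum-c ⟩
        (+ u ℤ.- + t) ℤ.+ (+ minus c ℤ.+ + t)        ≡⟨ lemma′ (+ u) (+ minus c) (+ t) ⟩
        + u ℤ.+ + minus c                            ∎)
        where
        open ≡-Reasoning
        lemma : ∀ p m t → p ℤ.+ t ≡ (p ℤ.+ ℤ.- m) ℤ.+ (m ℤ.+ t)
        lemma = solve-∀
        lemma′ : ∀ u m t → (u ℤ.- t) ℤ.+ (m ℤ.+ t) ≡ u ℤ.+ m
        lemma′ = solve-∀
        cancel : ∀ r u t → (r ℤ.+ u ℤ.- t) ℤ.- r ≡ u ℤ.- t
        cancel = solve-∀
        sum-c : + plus c ℤ.+ ℤ.- + minus c ≡ + u ℤ.- + t
        sum-c = begin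
          + plus c ℤ.+ ℤ.- + minus c                        ≡⟨ sumOver-⊤-± c ⟨
          sumOver ⊤ c                                       ≡⟨ sumOver-minus ⊤ q x ⟩
          sumOver ⊤ q ℤ.- sumOver ⊤ x                       ≡⟨ cong₂ ℤ._-_ total (proj₁ base) ⟩
          (+ rank ⊤ ℤ.+ + u ℤ.- + t) ℤ.- + rank ⊤           ≡⟨ cancel (+ rank ⊤) (+ u) (+ t) ⟩
          + u ℤ.- + t                                       ∎

      sum-a : Vec.sum a ≡ u
      sum-a = trans (sum-mapHead (Vec.map posPart c)) (ℕ.m+[n∸m]≡n plus≤u)

      sum-b : Vec.sum b ≡ t
      sum-b = trans (sum-mapHead (Vec.map negPart c)) (ℕ.+-cancelˡ-≡ (plus c) _ _ (begin
        plus c ℕ.+ (minus c ℕ.+ w)   ≡⟨ cong (plus c ℕ.+_) (ℕ.+-comm (minus c) w) ⟩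
        plus c ℕ.+ (w ℕ.+ minus c)   ≡⟨ ℕ.+-assoc (plus c) w (minus c) ⟨
        (plus c ℕ.+ w) ℕ.+ minus c   ≡⟨ cong (ℕ._+ minus c) (ℕ.m+[n∸m]≡n plus≤u) ⟩
        u ℕ.+ minus c                ≡⟨ balance ⟨
        plus c ℕ.+ t                 ∎))
        where open ≡-Reasoning

      parts : ∀ z → + posPart z ℤ.- + negPart z ≡ z
      parts (+ k)    = ℤ.+-identityʳ (+ k)
      parts -[1+ k ] = refl

      -- The added amount `v` is `w` in the first coordinate and zero in all others.
      shifted : ∀ z y v → y ℤ.+ (+ posPart (z ℤ.- y) ℤ.+ v) ℤ.- (+ negPart (z ℤ.- y) ℤ.+ v) ≡ z
      shifted z y v = trans (lemma y (+ posPart (z ℤ.- y)) (+ negPart (z ℤ.- y)) v)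
        (trans (+-congˡ y (parts (z ℤ.- y))) (lemma′ y z))
        where
        lemma : ∀ y p n v → y ℤ.+ (p ℤ.+ v) ℤ.- (n ℤ.+ v) ≡ y ℤ.+ (p ℤ.- n)
        lemma = solve-∀
        lemma′ : ∀ y z → y ℤ.+ (z ℤ.- y) ≡ z
        lemma′ = solve-∀

      reassemble : ∀ {n} (q x : Vec ℤ (suc n)) → let c = zipWith ℤ._-_ q x in
        zipWith ℤ._-_ (zipWith ℤ._+_ x (Vec.map +_ (mapHead (ℕ._+ w) (Vec.map posPart c))))
                      (Vec.map +_ (mapHead (ℕ._+ w) (Vec.map negPart c))) ≡ q
      reassemble (z ∷ q) (y ∷ x) = cong₂ _∷_ (shifted z y (+ w)) (go q x)
        where
        go : ∀ {n} (q x : Vec ℤ n) → let c = zipWith ℤ._-_ q x in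
          zipWith ℤ._-_ (zipWith ℤ._+_ x (Vec.map +_ (Vec.map posPart c))) (Vec.map +_ (Vec.map negPart c)) ≡ q
        go []      []      = refl
        go (z ∷ q) (y ∷ x) = cong₂ _∷_
          (trans (cong₂ (λ i j → y ℤ.+ i ℤ.- j) (sym (ℤ.+-identityʳ _)) (sym (ℤ.+-identityʳ _))) (shifted z y ℤ.0ℤ))
          (go q x)

-- The number of lattice points as a sum over subsets avoiding the first element.

module Counting where
  open ≡
  open import Data.Nat.Base using (_+_; _*_; _∸_; _≤_)
  open ℤ-Solver using (solve-∀)
  open Cardinality
  open Orthants
  open Bases
  open Polytopes
  open Decomposition

  module _ {m : ℕ} (M : Matroid (suc m)) where
    open Matroid M

    β γ : Subset m → ℕ
    β A = rank (outside ∷ A)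
    γ A = totalRank ∸ rank (inside ∷ A)

    γ-exact : ∀ A → γ A + rank (inside ∷ A) ≡ totalRank
    γ-exact A = ℕ.m∸n+n≡m (rank-mono (Subset.⊆-max (inside ∷ A)))

    -- The second argument is t + (b - γ) rather than (t - γ) + b: the inner subtraction is exact by
    -- `γ≤∣∁∣`, and the expression is also right when t < γ, where the fibre is empty and the
    -- binomial vanishes. It is thus a single polynomial for all t.
    count : (t u : ℕ) → Subset m → ℕ
    count t u A = ((u + β A) C ∣ A ∣) * ((t + (∣ ∁ A ∣ ∸ γ A)) C ∣ ∁ A ∣)

    -- Submodularity for A ∪ e and the complement of A, whose union is E: the complement raises the
    -- rank of A ∪ e by at most its own size.
    γ≤∣∁∣ : ∀ A → γ A ≤ ∣ ∁ A ∣
    γ≤∣∁∣ A = ℕ.m≤n+o⇒m∸n≤o totalRank (rank (inside ∷ A)) (begin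
      rank ⊤                                                     ≡⟨ cong (rank ∘ (inside ∷_)) (Subset.∪-inverseʳ A) ⟨
      rank ((inside ∷ A) ∪ (outside ∷ ∁ A))                      ≤⟨ ℕ.m≤m+n _ _ ⟩
      rank ((inside ∷ A) ∪ (outside ∷ ∁ A)) + rank ((inside ∷ A) ∩ (outside ∷ ∁ A)) ≤⟨ rank-submod _ _ ⟩
      rank (inside ∷ A) + rank (outside ∷ ∁ A)                   ≤⟨ ℕ.+-monoʳ-≤ (rank (inside ∷ A)) (rank-≤ (outside ∷ ∁ A)) ⟩
      rank (inside ∷ A) + ∣ ∁ A ∣                                ∎)
      where open ℕ.≤-Reasoning

    -- The first condition is the inequality for A. Since q(E) = r(E) + u - t, the sum of q over A ∪
    -- e is r(E) + u - t + `minus v`, so the inequality for A ∪ e becomes the second condition.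
    Projected : (t u : ℕ) → Vec ℤ m → Set
    Projected t u v = plus v ≤ u + β (pos v) × minus v + γ (pos v) ≤ t

    card-projected : ∀ t u → HasCardinality (Projected t u) (subsetSum (count t u))
    card-projected t u = card-fibres pos fibre
      where
      fibre : ∀ A → HasCardinality (λ v → pos v ≡ A × Projected t u v) (count t u A)
      fibre A with γ A ℕ.≤? t
      ... | yes γ≤t = subst (HasCardinality _) count-eq
        (card-resp (λ v → mk⇔ (λ { (refl , p , k) → refl , p , ℕ.≤-trans (ℕ.+-monoˡ-≤ _ k) (ℕ.≤-reflexive (ℕ.m∸n+n≡m γ≤t)) })
                              (λ { (refl , p , k) → refl , p , ℕ.m+n≤o⇒m≤o∸n _ k }))
                   (card-orthant A (u + β A) (t ∸ γ A)))
        where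
        count-eq : ((u + β A) C ∣ A ∣) * ((t ∸ γ A + ∣ ∁ A ∣) C ∣ ∁ A ∣) ≡ count t u A
        count-eq = cong (λ k → ((u + β A) C ∣ A ∣) * (k C ∣ ∁ A ∣))
          (trans (sym (ℕ.+-∸-comm ∣ ∁ A ∣ γ≤t)) (ℕ.+-∸-assoc t (γ≤∣∁∣ A)))
      ... | no γ≰t = subst (HasCardinality _) (sym count≡0)
        (card-∅ λ { v (refl , _ , k) → γ≰t (ℕ.≤-trans (ℕ.m≤n+m _ (minus v)) k) })
        where
        below : t + (∣ ∁ A ∣ ∸ γ A) ℕ.< ∣ ∁ A ∣
        below = ℕ.<-≤-trans (ℕ.+-monoˡ-< (∣ ∁ A ∣ ∸ γ A) (ℕ.≰⇒> γ≰t)) (ℕ.≤-reflexive (ℕ.m+[n∸m]≡n (γ≤∣∁∣ A)))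
        count≡0 : count t u A ≡ 0
        count≡0 = trans (cong (((u + β A) C ∣ A ∣) *_) (k>n⇒nCk≡0 below)) (ℕ.*-zeroʳ ((u + β A) C ∣ A ∣))

    card-lattice : ∀ t u → HasCardinality (LatticePoint M t u) (subsetSum (count t u))
    card-lattice t u = card-resp (λ q → mk⇔ (to q) (from q)) (card-image extend ∷-injectiveʳ (card-projected t u))
      where
      total : ℤ
      total = + rank ⊤ ℤ.+ + u ℤ.- + t
      extend : Vec ℤ m → Vec ℤ (suc m)
      extend v = (total ℤ.- sumOver ⊤ v) ∷ v

      to : ∀ q → ∃[ v ] Projected t u v × q ≡ extend v → LatticePoint M t u q
      to _ (v , (p , k) , refl) = lattice-intro M {t} {u} (lemma total (sumOver ⊤ v)) (bound (isPos (total ℤ.- sumOver ⊤ v)))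
        where
        open ℤ.≤-Reasoning
        lemma : ∀ a b → (a ℤ.- b) ℤ.+ b ≡ a
        lemma = solve-∀
        expand : ∀ r u t p k → (r ℤ.+ u ℤ.- t ℤ.- (p ℤ.- k)) ℤ.+ p ≡ (k ℤ.+ r) ℤ.+ (u ℤ.- t)
        expand = solve-∀
        collect : ∀ k g r u t → (k ℤ.+ (g ℤ.+ r)) ℤ.+ (u ℤ.- t) ≡ (k ℤ.+ g) ℤ.+ (r ℤ.+ u ℤ.- t)
        collect = solve-∀
        finish : ∀ t r u → t ℤ.+ (r ℤ.+ u ℤ.- t) ≡ r ℤ.+ u
        finish = solve-∀
        r′ = + rank (inside ∷ pos v)
        -- The sign of the recovered first coordinate is not known; it decides whether the positive
        -- set is A or A ∪ e, and each possibility uses one half of `Projected`.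
        bound : ∀ s → sumOver (s ∷ pos v) (extend v) ℤ.≤ + rank (s ∷ pos v) ℤ.+ + u
        bound outside = begin
          ℤ.0ℤ ℤ.+ sumOver (pos v) v      ≡⟨ trans (ℤ.+-identityˡ _) (sumOver-pos v) ⟩
          + plus v                        ≤⟨ ℤ.+≤+ p ⟩
          + (u + β (pos v))               ≡⟨ cong +_ (ℕ.+-comm u (β (pos v))) ⟩
          + β (pos v) ℤ.+ + u             ∎
        bound inside = begin
          (total ℤ.- sumOver ⊤ v) ℤ.+ sumOver (pos v) v
            ≡⟨ cong₂ (λ a b → (total ℤ.- a) ℤ.+ b) (sumOver-⊤-± v) (sumOver-pos v) ⟩
          (total ℤ.- (+ plus v ℤ.- + minus v)) ℤ.+ + plus v
            ≡⟨ expand (+ rank ⊤) (+ u) (+ t) (+ plus v) (+ minus v) ⟩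
          (+ minus v ℤ.+ + rank ⊤) ℤ.+ (+ u ℤ.- + t)
            ≡⟨ cong (λ r → (+ minus v ℤ.+ + r) ℤ.+ (+ u ℤ.- + t)) (γ-exact (pos v)) ⟨
          (+ minus v ℤ.+ (+ γ (pos v) ℤ.+ r′)) ℤ.+ (+ u ℤ.- + t)
            ≡⟨ collect (+ minus v) (+ γ (pos v)) r′ (+ u) (+ t) ⟩
          (+ minus v ℤ.+ + γ (pos v)) ℤ.+ (r′ ℤ.+ + u ℤ.- + t)
            ≤⟨ ℤ.+-monoˡ-≤ (r′ ℤ.+ + u ℤ.- + t) (ℤ.+≤+ k) ⟩
          + t ℤ.+ (r′ ℤ.+ + u ℤ.- + t)
            ≡⟨ finish (+ t) r′ (+ u) ⟩
          r′ ℤ.+ + u ∎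

      from : ∀ q → LatticePoint M t u q → ∃[ v ] Projected t u v × q ≡ extend v
      from (z ∷ v) q∈ = v , (p , k) , cong (_∷ v) z≡
        where
        open ℤ.≤-Reasoning
        lemma : ∀ a b → a ≡ (a ℤ.+ b) ℤ.- b
        lemma = solve-∀
        z≡ : z ≡ total ℤ.- sumOver ⊤ v
        z≡ = trans (lemma z (sumOver ⊤ v)) (cong (ℤ._- sumOver ⊤ v) (lattice-⊤ M {t} {u} {z ∷ v} q∈))
        p : plus v ≤ u + β (pos v)
        p = ℤ.drop‿+≤+ (begin
          + plus v                        ≡⟨ trans (ℤ.+-identityˡ _) (sumOver-pos v) ⟨
          ℤ.0ℤ ℤ.+ sumOver (pos v) v      ≤⟨ lattice-≤ M {t} {u} {z ∷ v} q∈ (outside ∷ pos v) ⟩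
          + β (pos v) ℤ.+ + u             ≡⟨ cong +_ (ℕ.+-comm (β (pos v)) u) ⟩
          + (u + β (pos v))               ∎)
        r′ = + rank (inside ∷ pos v)
        expand : ∀ k g r u t p → k ℤ.+ g ≡ ((g ℤ.+ r) ℤ.+ u ℤ.- t ℤ.- (p ℤ.- k)) ℤ.+ p ℤ.+ (t ℤ.- r ℤ.- u)
        expand = solve-∀
        finish : ∀ t r u → (r ℤ.+ u) ℤ.+ (t ℤ.- r ℤ.- u) ≡ t
        finish = solve-∀
        -- The inequality for A ∪ e, with t - r(A ∪ e) - u added to both sides so that exactly t
        -- remains on the right.
        k : minus v + γ (pos v) ≤ t
        k = ℤ.drop‿+≤+ (begin
          + minus v ℤ.+ + γ (pos v)
            ≡⟨ expand (+ minus v) (+ γ (pos v)) r′ (+ u) (+ t) (+ plus v) ⟩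
          ((+ γ (pos v) ℤ.+ r′) ℤ.+ + u ℤ.- + t ℤ.- (+ plus v ℤ.- + minus v)) ℤ.+ + plus v ℤ.+ (+ t ℤ.- r′ ℤ.- + u)
            ≡⟨ cong (λ r → (+ r ℤ.+ + u ℤ.- + t ℤ.- (+ plus v ℤ.- + minus v)) ℤ.+ + plus v ℤ.+ (+ t ℤ.- r′ ℤ.- + u)) (γ-exact (pos v)) ⟩
          (total ℤ.- (+ plus v ℤ.- + minus v)) ℤ.+ + plus v ℤ.+ (+ t ℤ.- r′ ℤ.- + u)
            ≡⟨ cong₂ (λ a b → (total ℤ.- a) ℤ.+ b ℤ.+ (+ t ℤ.- r′ ℤ.- + u)) (sumOver-⊤-± v) (sumOver-pos v) ⟨
          (total ℤ.- sumOver ⊤ v) ℤ.+ sumOver (pos v) v ℤ.+ (+ t ℤ.- r′ ℤ.- + u)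
            ≡⟨ cong (λ a → a ℤ.+ sumOver (pos v) v ℤ.+ (+ t ℤ.- r′ ℤ.- + u)) z≡ ⟨
          z ℤ.+ sumOver (pos v) v ℤ.+ (+ t ℤ.- r′ ℤ.- + u)
            ≤⟨ ℤ.+-monoˡ-≤ (+ t ℤ.- r′ ℤ.- + u) (lattice-≤ M {t} {u} {z ∷ v} q∈ (inside ∷ pos v)) ⟩
          (r′ ℤ.+ + u) ℤ.+ (+ t ℤ.- r′ ℤ.- + u)
            ≡⟨ finish (+ t) r′ (+ u) ⟩
          + t ∎)

-- Existence of the expansion in products of binomials.

module Expansion where
  open ≡
  open import Data.Nat.Base using (_+_; _*_; _∸_; _<_; s≤s)
  open ℕ-Solver using (solve-∀)
  open Cardinality
  open Counting
  open RawMonoid ℤ.+-0-rawMonoid using () renaming (sum to sumℤ)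
  open CommutativeMonoidSum ℕ.+-0-commutativeMonoid using (∑-distrib-+)
  open SemiringSum ℕ.+-*-semiring using (sum; sum-cong-≗; *-distribˡ-sum; *-distribʳ-sum; sum-replicate-zero)

  -- The Kronecker delta, by simultaneous recursion so that `sum-unit` peels off one index at a
  -- time.
  unit : ℕ → ∀ {N} → Fin N → ℕ
  unit zero    zero    = 1
  unit zero    (suc _) = 0
  unit (suc a) zero    = 0
  unit (suc a) (suc j) = unit a j

  sum-unit : ∀ {N} (f : ℕ → ℕ) {a} → a < N → sum {N} (λ j → unit a j * f (toℕ j)) ≡ f a
  sum-unit {suc N} f {zero}  _         =
    trans (cong₂ _+_ (ℕ.*-identityˡ (f 0)) (sum-replicate-zero N)) (ℕ.+-identityʳ (f 0))
  sum-unit {suc N} f {suc a} (s≤s a<N) = sum-unit {N} (λ j → f (suc j)) a<N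

  -- The coefficients of C(u + β, a) in the basis C(u, j); they are C(β, a - j), but
  -- Pascal's rule avoids Vandermonde's convolution.
  newton : ℕ → ℕ → ∀ {N} → Fin N → ℕ
  newton zero    a       j = unit a j
  newton (suc β) zero    j = unit 0 j
  newton (suc β) (suc a) j = newton β a j + newton β (suc a) j

  newton-expand : ∀ {N} β a → a < N → ∀ u → (u + β) C a ≡ sum {N} (λ j → newton β a j * (u C toℕ j))
  newton-expand {N} zero    a       a<N u = trans (cong (_C a) (ℕ.+-identityʳ u)) (sym (sum-unit {N} (u C_) a<N))
  newton-expand {N} (suc β) zero    a<N u = sym (sum-unit {N} (u C_) a<N)
  newton-expand {N} (suc β) (suc a) a<N u = begin
    (u + suc β) C suc a                    ≡⟨ cong (_C suc a) (ℕ.+-suc u β) ⟩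
    suc (u + β) C suc a                    ≡⟨ nCk+nC[k+1]≡[n+1]C[k+1] (u + β) a ⟨
    (u + β) C a + (u + β) C suc a          ≡⟨ cong₂ _+_ (newton-expand β a (ℕ.<-trans (ℕ.n<1+n a) a<N) u) (newton-expand β (suc a) a<N u) ⟩
    sum {N} (λ j → newton β a j * (u C toℕ j)) + sum {N} (λ j → newton β (suc a) j * (u C toℕ j))
      ≡⟨ ∑-distrib-+ {N} (λ j → newton β a j * (u C toℕ j)) (λ j → newton β (suc a) j * (u C toℕ j)) ⟨
    sum {N} (λ j → newton β a j * (u C toℕ j) + newton β (suc a) j * (u C toℕ j))
      ≡⟨ sum-cong-≗ {N} (λ j → sym (ℕ.*-distribʳ-+ (u C toℕ j) (newton β a j) (newton β (suc a) j))) ⟩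
    sum {N} (λ j → newton (suc β) (suc a) j * (u C toℕ j)) ∎
    where open ≡-Reasoning

  -- The truncation `N` is common to all subsets, so the expansions of their contributions are added
  -- coefficientwise.
  record Expandable (N : ℕ) (F : ℕ → ℕ → ℕ) : Set where
    constructor _,_
    field
      coefficient : Fin N → Fin N → ℕ
      expands     : ∀ t u → F t u ≡
        sum {N} (λ i → sum {N} (λ j → coefficient i j * (u C toℕ j) * (t C toℕ i)))

  open Expandable

  expandable-+ : ∀ {N F G} → Expandable N F → Expandable N G → Expandable N (λ t u → F t u + G t u)
  expandable-+ {N} {F} {G} (c , F≡) (d , G≡) = (λ i j → c i j + d i j) , λ t u → begin
    F t u + G t u
      ≡⟨ cong₂ _+_ (F≡ t u) (G≡ t u) ⟩
    sum {N} (λ i → sum {N} (λ j → c i j * (u C toℕ j) * (t C toℕ i))) + sum {N} (λ i → sum {N} (λ j → d i j * (u C toℕ j) * (t C toℕ i)))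
      ≡⟨ ∑-distrib-+ {N} (λ i → sum {N} (λ j → c i j * (u C toℕ j) * (t C toℕ i))) (λ i → sum {N} (λ j → d i j * (u C toℕ j) * (t C toℕ i))) ⟨
    sum {N} (λ i → sum {N} (λ j → c i j * (u C toℕ j) * (t C toℕ i)) + sum {N} (λ j → d i j * (u C toℕ j) * (t C toℕ i)))
      ≡⟨ sum-cong-≗ {N} (λ i → trans (sym (∑-distrib-+ {N} (λ j → c i j * (u C toℕ j) * (t C toℕ i)) (λ j → d i j * (u C toℕ j) * (t C toℕ i))))
           (sum-cong-≗ {N} λ j → distrib (c i j) (d i j) (u C toℕ j) (t C toℕ i))) ⟩
    sum {N} (λ i → sum {N} (λ j → (c i j + d i j) * (u C toℕ j) * (t C toℕ i))) ∎
    where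
    open ≡-Reasoning
    distrib : ∀ a b p q → a * p * q + b * p * q ≡ (a + b) * p * q
    distrib = solve-∀

  expandable-* : ∀ {N} β a → a < N → ∀ δ b → b < N →
                 Expandable N (λ t u → ((u + β) C a) * ((t + δ) C b))
  expandable-* {N} β a a<N δ b b<N = (λ i j → newton δ b i * newton β a j) , λ t u → begin
    ((u + β) C a) * ((t + δ) C b)
      ≡⟨ cong (((u + β) C a) *_) (newton-expand δ b b<N t) ⟩
    ((u + β) C a) * sum {N} (λ i → newton δ b i * (t C toℕ i))
      ≡⟨ *-distribˡ-sum {N} ((u + β) C a) (λ i → newton δ b i * (t C toℕ i)) ⟩
    sum {N} (λ i → ((u + β) C a) * (newton δ b i * (t C toℕ i)))
      ≡⟨ sum-cong-≗ {N} (λ i → trans (cong (_* (newton δ b i * (t C toℕ i))) (newton-expand β a a<N u))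
          (trans (*-distribʳ-sum {N} (newton δ b i * (t C toℕ i)) (λ j → newton β a j * (u C toℕ j)))
            (sum-cong-≗ {N} λ j → rearrange (newton β a j) (u C toℕ j) (newton δ b i) (t C toℕ i)))) ⟩
    sum {N} (λ i → sum {N} (λ j → newton δ b i * newton β a j * (u C toℕ j) * (t C toℕ i))) ∎
    where
    open ≡-Reasoning
    rearrange : ∀ p q r s → p * q * (r * s) ≡ r * p * q * s
    rearrange = solve-∀

  expandable-subsetSum : ∀ {N m} {F : ℕ → ℕ → Subset m → ℕ} → (∀ A → Expandable N (λ t u → F t u A)) →
                         Expandable N (λ t u → subsetSum (F t u))
  expandable-subsetSum {m = zero}  h = h []
  expandable-subsetSum {m = suc m} h = expandable-+ (expandable-subsetSum (λ A → h (outside ∷ A)))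
                                                    (expandable-subsetSum (λ A → h (inside ∷ A)))

  sumℤ-+ : ∀ {N} (f : Fin N → ℕ) (g : Fin N → ℤ) → (∀ i → g i ≡ + f i) → + sum f ≡ sumℤ g
  sumℤ-+ {zero}  f g g≡ = refl
  sumℤ-+ {suc N} f g g≡ = cong₂ ℤ._+_ (sym (g≡ zero)) (sumℤ-+ (λ i → f (suc i)) (λ i → g (suc i)) (λ i → g≡ (suc i)))

  latticeCount : ∀ {m} (M : Matroid (suc m)) → LatticeCount M
  latticeCount {m} M = record
    { Q         = λ t u → subsetSum (count M t u)
    ; Q-counts  = card-lattice M
    -- Each contribution has degree at most `m` in each of the two variables, so the indices 0 to
    -- `m` suffice.
    ; size      = suc m
    ; coeff     = λ i j → + coefficient expansion i j
    ; expansion = λ t u → trans (cong +_ (expands expansion t u)) (sumℤ-+ {suc m} _ _ λ i → sym (sumℤ-+ {suc m} _ _ λ j →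
        trans (cong (ℤ._* + (t C toℕ i)) (sym (ℤ.pos-* (coefficient expansion i j) (u C toℕ j))))
              (sym (ℤ.pos-* (coefficient expansion i j * (u C toℕ j)) (t C toℕ i)))))
    }
    where
    expansion : Expandable (suc m) (λ t u → subsetSum (count M t u))
    expansion = expandable-subsetSum λ A →
      expandable-* (β M A) (∣ A ∣) (s≤s (Subset.∣p∣≤n A)) (∣ ∁ A ∣ ∸ γ M A) (∣ ∁ A ∣) (s≤s (Subset.∣p∣≤n (∁ A)))

-- The operator that replaces binomials by powers, and its value on the lattice point count.

module Umbral {c ℓ} (R : CommutativeRing c ℓ) where
  open import Data.Nat.Base using (_∸_; _≤_; _<_; s≤s)
  open Cardinality
  open Counting
  open CommutativeRing R hiding (zero)
    renaming (_+_ to infixl 6 _+_; _*_ to infixl 7 _*_; -_ to infix 8 -_)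
  open Evaluation R using (fromℤ; sumSubsets; Q′)
  open RawSemiring (Semiring.rawSemiring semiring) using (sum; _^_) renaming (_×_ to _·_)
  open RingProperties ring using (-0#≈0#; -‿distribʳ-*; -‿+-comm)
  open SemiringMult semiring using (×-homo-+; ×1-homo-*)
  open SemiringSum semiring using (sum-cong-≋)
  open CommutativeSemigroup +-commutativeSemigroup
    using () renaming (interchange to +-interchange)
  open CommutativeSemigroup *-commutativeSemigroup
    using (x∙yz≈y∙xz; xy∙z≈xz∙y)
  open SetoidReasoning setoid

  -‿zero : ∀ a → a - 0# ≈ a
  -‿zero a = trans (+-congˡ -0#≈0#) (+-identityʳ a)

  -‿interchange : ∀ a b c d → (a + b) - (c + d) ≈ (a - c) + (b - d)
  -‿interchange a b c d = trans (+-congˡ (sym (-‿+-comm c d))) (+-interchange a b (- c) (- d))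

  a+b-a≈b : ∀ a b → (a + b) - a ≈ b
  a+b-a≈b a b = trans (+-congʳ (+-comm a b)) (trans (+-assoc b a (- a)) (trans (+-congˡ (-‿inverseʳ a)) (+-identityʳ b)))

  fromℤ-⊖ : ∀ m n → fromℤ (m ⊖ n) ≈ (m · 1#) - (n · 1#)
  fromℤ-⊖ zero    zero    = sym (-‿zero 0#)
  fromℤ-⊖ zero    (suc n) = sym (+-identityˡ _)
  fromℤ-⊖ (suc m) zero    = sym (-‿zero _)
  fromℤ-⊖ (suc m) (suc n) = begin
    fromℤ (suc m ⊖ suc n)               ≡⟨ ≡.cong fromℤ (ℤ.[1+m]⊖[1+n]≡m⊖n m n) ⟩
    fromℤ (m ⊖ n)                       ≈⟨ fromℤ-⊖ m n ⟩
    (m · 1#) - (n · 1#)                 ≈⟨ +-identityˡ _ ⟨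
    0# + ((m · 1#) - (n · 1#))          ≈⟨ +-congʳ (-‿inverseʳ 1#) ⟨
    (1# - 1#) + ((m · 1#) - (n · 1#))   ≈⟨ -‿interchange 1# (m · 1#) 1# (n · 1#) ⟨
    (suc m · 1#) - (suc n · 1#)         ∎

  fromℤ-+ : ∀ a b → fromℤ (a ℤ.+ b) ≈ fromℤ a + fromℤ b
  fromℤ-+ (+ m)    (+ n)    = ×-homo-+ 1# m n
  fromℤ-+ (+ m)    -[1+ n ] = fromℤ-⊖ m (suc n)
  fromℤ-+ -[1+ m ] (+ n)    = trans (fromℤ-⊖ n (suc m)) (+-comm _ _)
  fromℤ-+ -[1+ m ] -[1+ n ] = begin
    - (suc (suc (m ℕ.+ n)) · 1#)          ≡⟨ ≡.cong (λ k → - (suc k · 1#)) (ℕ.+-suc m n) ⟨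
    - ((suc m ℕ.+ suc n) · 1#)            ≈⟨ -‿cong (×-homo-+ 1# (suc m) (suc n)) ⟩
    - ((suc m · 1#) + (suc n · 1#))       ≈⟨ -‿+-comm _ _ ⟨
    - (suc m · 1#) - (suc n · 1#)         ∎

  fromℤ-*ℕ : ∀ a k → fromℤ (a ℤ.* + k) ≈ fromℤ a * (k · 1#)
  fromℤ-*ℕ a zero    = trans (reflexive (≡.cong fromℤ (ℤ.*-zeroʳ a))) (sym (zeroʳ (fromℤ a)))
  fromℤ-*ℕ a (suc k) = begin
    fromℤ (a ℤ.* (ℤ.1ℤ ℤ.+ + k))            ≡⟨ ≡.cong fromℤ (≡.trans (ℤ.*-distribˡ-+ a ℤ.1ℤ (+ k)) (≡.cong (ℤ._+ a ℤ.* + k) (ℤ.*-identityʳ a))) ⟩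
    fromℤ (a ℤ.+ a ℤ.* + k)                 ≈⟨ fromℤ-+ a (a ℤ.* + k) ⟩
    fromℤ a + fromℤ (a ℤ.* + k)             ≈⟨ +-cong (sym (*-identityʳ (fromℤ a))) (fromℤ-*ℕ a k) ⟩
    fromℤ a * 1# + fromℤ a * (k · 1#)       ≈⟨ distribˡ (fromℤ a) 1# (k · 1#) ⟨
    fromℤ a * (suc k · 1#)                  ∎

  open RawMonoid ℤ.+-0-rawMonoid using () renaming (sum to sumℤ)

  fromℤ-sum : ∀ {N} (f : Fin N → ℤ) → fromℤ (sumℤ f) ≈ sum (λ i → fromℤ (f i))
  fromℤ-sum {zero}  f = refl
  fromℤ-sum {suc N} f = trans (fromℤ-+ (f zero) _) (+-congˡ (fromℤ-sum (λ i → f (suc i))))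

  fromℕ-subsetSum : ∀ {m} (f : Subset m → ℕ) → subsetSum f · 1# ≈ sumSubsets (λ A → f A · 1#)
  fromℕ-subsetSum {zero}  f = refl
  fromℕ-subsetSum {suc m} f = trans (×-homo-+ 1# (subsetSum (λ A → f (outside ∷ A))) _)
    (+-cong (fromℕ-subsetSum (λ A → f (outside ∷ A))) (fromℕ-subsetSum (λ A → f (inside ∷ A))))

  sumSubsets-cong : ∀ {m} {f g : Subset m → Carrier} → (∀ A → f A ≈ g A) → sumSubsets f ≈ sumSubsets g
  sumSubsets-cong {zero}  h = h []
  sumSubsets-cong {suc m} h = +-cong (sumSubsets-cong (λ A → h (outside ∷ A))) (sumSubsets-cong (λ A → h (inside ∷ A)))

  sumSubsets-+ : ∀ {m} (f g : Subset m → Carrier) →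
                 sumSubsets (λ A → f A + g A) ≈ sumSubsets f + sumSubsets g
  sumSubsets-+ {zero}  f g = refl
  sumSubsets-+ {suc m} f g = trans (+-cong (sumSubsets-+ {m} _ _) (sumSubsets-+ {m} _ _)) (+-interchange _ _ _ _)

  sumSubsets-* : ∀ {m} a (f : Subset m → Carrier) → a * sumSubsets f ≈ sumSubsets (λ A → a * f A)
  sumSubsets-* {zero}  a f = refl
  sumSubsets-* {suc m} a f = trans (distribˡ a _ _) (+-cong (sumSubsets-* {m} a _) (sumSubsets-* {m} a _))

  -- The linear map Σ_j c_j C(u, j) ↦ Σ_j c_j z^j on functions of degree less than N,
  -- through Newton's formula c_j = (Δ^j f)(0). It depends on f only, which makes the
  -- uniqueness of the coefficients c_j unnecessary.
  umbral : ℕ → Carrier → (ℕ → Carrier) → Carrier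
  umbral zero    z f = 0#
  umbral (suc N) z f = f 0 + z * umbral N z (λ u → f (suc u) - f u)

  umbral-cong : ∀ N z {f g} → (∀ u → f u ≈ g u) → umbral N z f ≈ umbral N z g
  umbral-cong zero    z h = refl
  umbral-cong (suc N) z h =
    +-cong (h 0) (*-congˡ (umbral-cong N z λ u → +-cong (h (suc u)) (-‿cong (h u))))

  umbral-0 : ∀ N z → umbral N z (λ _ → 0#) ≈ 0#
  umbral-0 zero    z = refl
  umbral-0 (suc N) z = trans (+-identityˡ _)
    (trans (*-congˡ (trans (umbral-cong N z (λ _ → -‿inverseʳ 0#)) (umbral-0 N z))) (zeroʳ z))

  umbral-+ : ∀ N z f g → umbral N z (λ u → f u + g u) ≈ umbral N z f + umbral N z g
  umbral-+ zero    z f g = sym (+-identityˡ 0#)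
  umbral-+ (suc N) z f g = begin
    f 0 + g 0 + z * umbral N z (λ u → (f (suc u) + g (suc u)) - (f u + g u))
      ≈⟨ +-congˡ (*-congˡ (umbral-cong N z (λ u → -‿interchange (f (suc u)) (g (suc u)) (f u) (g u)))) ⟩
    f 0 + g 0 + z * umbral N z (λ u → (f (suc u) - f u) + (g (suc u) - g u))
      ≈⟨ +-congˡ (trans (*-congˡ (umbral-+ N z _ _)) (distribˡ z _ _)) ⟩
    f 0 + g 0 + (z * umbral N z (λ u → f (suc u) - f u) + z * umbral N z (λ u → g (suc u) - g u))
      ≈⟨ +-interchange _ _ _ _ ⟩
    umbral (suc N) z f + umbral (suc N) z g ∎

  umbral-* : ∀ N z a f → umbral N z (λ u → a * f u) ≈ a * umbral N z f
  umbral-* zero    z a f = sym (zeroʳ a)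
  umbral-* (suc N) z a f = begin
    a * f 0 + z * umbral N z (λ u → a * f (suc u) - a * f u)
      ≈⟨ +-congˡ (*-congˡ (umbral-cong N z λ u → trans (+-congˡ (-‿distribʳ-* a (f u))) (sym (distribˡ a _ _)))) ⟩
    a * f 0 + z * umbral N z (λ u → a * (f (suc u) - f u))
      ≈⟨ +-congˡ (trans (*-congˡ (umbral-* N z a _)) (x∙yz≈y∙xz z a _)) ⟩
    a * f 0 + a * (z * umbral N z (λ u → f (suc u) - f u))
      ≈⟨ distribˡ a _ _ ⟨
    a * umbral (suc N) z f ∎

  umbral-*ʳ : ∀ N z a f → umbral N z (λ u → f u * a) ≈ umbral N z f * a
  umbral-*ʳ N z a f = trans (umbral-cong N z (λ u → *-comm (f u) a)) (trans (umbral-* N z a f) (*-comm a _))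

  umbral-sum : ∀ N z {K} (f : Fin K → ℕ → Carrier) →
               umbral N z (λ u → sum (λ i → f i u)) ≈ sum (λ i → umbral N z (f i))
  umbral-sum N z {zero}  f = umbral-0 N z
  umbral-sum N z {suc K} f = trans (umbral-+ N z (f zero) _) (+-congˡ (umbral-sum N z (λ i → f (suc i))))

  umbral-subsets : ∀ N z {m} (f : Subset m → ℕ → Carrier) →
                   umbral N z (λ u → sumSubsets (λ A → f A u)) ≈ sumSubsets (λ A → umbral N z (f A))
  umbral-subsets N z {zero}  f = refl
  umbral-subsets N z {suc m} f = trans (umbral-+ N z _ _)
    (+-cong (umbral-subsets N z (λ A → f (outside ∷ A))) (umbral-subsets N z (λ A → f (inside ∷ A))))

  pascal : ∀ n k → ((suc n C suc k) · 1#) ≈ ((n C k) · 1#) + ((n C suc k) · 1#)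
  pascal n k = trans (reflexive (≡.cong (_· 1#) (≡.sym (nCk+nC[k+1]≡[n+1]C[k+1] n k)))) (×-homo-+ 1# (n C k) _)

  -- The forward difference of C(u, j + 1) is C(u, j), and C(0, j + 1) = 0, so every unfolding of
  -- `umbral` contributes one factor z.
  umbral-binomial : ∀ N z j → j < N → umbral N z (λ u → (u C j) · 1#) ≈ z ^ j
  umbral-binomial (suc N) z zero    _ = begin
    (1 · 1#) + z * umbral N z (λ u → (1 · 1#) - (1 · 1#))
      ≈⟨ +-cong (+-identityʳ 1#) (*-congˡ (trans (umbral-cong N z (λ _ → -‿inverseʳ (1 · 1#))) (umbral-0 N z))) ⟩
    1# + z * 0#     ≈⟨ trans (+-congˡ (zeroʳ z)) (+-identityʳ 1#) ⟩
    1#              ∎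
  umbral-binomial (suc N) z (suc j) (s≤s j<N) = trans (+-identityˡ _) (*-congˡ (begin
    umbral N z (λ u → ((suc u C suc j) · 1#) - ((u C suc j) · 1#))
      ≈⟨ umbral-cong N z (λ u → trans (+-congʳ (trans (pascal u j) (+-comm _ _))) (a+b-a≈b ((u C suc j) · 1#) _)) ⟩
    umbral N z (λ u → (u C j) · 1#)
      ≈⟨ umbral-binomial N z j j<N ⟩
    z ^ j ∎))

  -- Pascal's rule splits C(u + β + 1, a + 1) into shifts by β with lower indices a and a + 1. Their
  -- images differ by a factor z, as β ≤ a makes the exponent grow by exactly one, and together they
  -- give the new factor 1 + z.
  umbral-shifted : ∀ N z β a → β ≤ a → a < N →
                   umbral N z (λ u → ((u ℕ.+ β) C a) · 1#) ≈ (1# + z) ^ β * z ^ (a ∸ β)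
  umbral-shifted N z zero    a       _   a<N = begin
    umbral N z (λ u → ((u ℕ.+ 0) C a) · 1#)
      ≈⟨ umbral-cong N z (λ u → reflexive (≡.cong (λ k → (k C a) · 1#) (ℕ.+-identityʳ u))) ⟩
    umbral N z (λ u → (u C a) · 1#)
      ≈⟨ umbral-binomial N z a a<N ⟩
    z ^ a
      ≈⟨ *-identityˡ (z ^ a) ⟨
    1# * z ^ a ∎
  umbral-shifted N z (suc β) (suc a) (s≤s β≤a) a<N = begin
    umbral N z (λ u → ((u ℕ.+ suc β) C suc a) · 1#)
      ≈⟨ umbral-cong N z (λ u → trans (reflexive (≡.cong (λ k → (k C suc a) · 1#) (ℕ.+-suc u β))) (pascal (u ℕ.+ β) a)) ⟩
    umbral N z (λ u → (((u ℕ.+ β) C a) · 1#) + (((u ℕ.+ β) C suc a) · 1#))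
      ≈⟨ umbral-+ N z _ _ ⟩
    umbral N z (λ u → ((u ℕ.+ β) C a) · 1#) + umbral N z (λ u → ((u ℕ.+ β) C suc a) · 1#)
      ≈⟨ +-cong (umbral-shifted N z β a β≤a (ℕ.<-trans (ℕ.n<1+n a) a<N))
                (umbral-shifted N z β (suc a) (ℕ.m≤n⇒m≤1+n β≤a) a<N) ⟩
    (1# + z) ^ β * z ^ (a ∸ β) + (1# + z) ^ β * z ^ (suc a ∸ β)
      ≡⟨ ≡.cong (λ k → (1# + z) ^ β * z ^ (a ∸ β) + (1# + z) ^ β * z ^ k) (ℕ.+-∸-assoc 1 β≤a) ⟩
    (1# + z) ^ β * z ^ (a ∸ β) + (1# + z) ^ β * (z * z ^ (a ∸ β))
      ≈⟨ +-cong (sym (*-identityˡ _)) (x∙yz≈y∙xz _ z _) ⟩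
    1# * ((1# + z) ^ β * z ^ (a ∸ β)) + z * ((1# + z) ^ β * z ^ (a ∸ β))
      ≈⟨ distribʳ _ 1# z ⟨
    (1# + z) * ((1# + z) ^ β * z ^ (a ∸ β))
      ≈⟨ *-assoc (1# + z) _ _ ⟨
    (1# + z) ^ suc β * z ^ (suc a ∸ suc β) ∎

  umbral² : ℕ → Carrier → Carrier → (ℕ → ℕ → Carrier) → Carrier
  umbral² N x y F = umbral N x (λ t → umbral N y (λ u → F t u))

  umbral²-cong : ∀ N x y {F G} → (∀ t u → F t u ≈ G t u) → umbral² N x y F ≈ umbral² N x y G
  umbral²-cong N x y h = umbral-cong N x (λ t → umbral-cong N y (h t))

  umbral²-* : ∀ N x y f g → umbral² N x y (λ t u → f u * g t) ≈ umbral N y f * umbral N x g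
  umbral²-* N x y f g = trans (umbral-cong N x (λ t → umbral-*ʳ N y (g t) f)) (umbral-* N x (umbral N y f) g)

  -- The right-hand side mentions only the values of `Q`. The operator is applied term by term to
  -- whichever expansion `L` supplies, and `N` has to exceed every index occurring there.
  Q′-umbral : ∀ {n} {M : Matroid n} (L : LatticeCount M) N → LatticeCount.size L ≤ N → ∀ x y →
              Q′ L x y ≈ umbral² N (x - 1#) (y - 1#) (λ t u → fromℤ (+ LatticeCount.Q L t u))
  Q′-umbral L N size≤N x y = sym (begin
    umbral² N X Y (λ t u → fromℤ (+ Q t u))
      ≈⟨ umbral²-cong N X Y expand ⟩
    umbral² N X Y (λ t u → sum (λ i → sum (λ j → term i j t u)))
      ≈⟨ umbral-cong N X (λ t → trans (umbral-sum N Y (λ i u → sum (λ j → term i j t u)))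
           (sum-cong-≋ (λ i → umbral-sum N Y (λ j u → term i j t u)))) ⟩
    umbral N X (λ t → sum (λ i → sum (λ j → umbral N Y (λ u → term i j t u))))
      ≈⟨ trans (umbral-sum N X (λ i t → sum (λ j → umbral N Y (λ u → term i j t u))))
           (sum-cong-≋ (λ i → umbral-sum N X (λ j t → umbral N Y (λ u → term i j t u)))) ⟩
    sum (λ i → sum (λ j → umbral² N X Y (term i j)))
      ≈⟨ sum-cong-≋ (λ i → sum-cong-≋ (λ j → evaluate i j)) ⟩
    sum (λ i → sum (λ j → fromℤ (coeff i j) * X ^ toℕ i * Y ^ toℕ j)) ∎)
    where
    open LatticeCount L
    X = x - 1#
    Y = y - 1#
    term : Fin size → Fin size → ℕ → ℕ → Carrier
    term i j t u = fromℤ (coeff i j) * ((u C toℕ j) · 1#) * ((t C toℕ i) · 1#)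
    expand : ∀ t u → fromℤ (+ Q t u) ≈ sum (λ i → sum (λ j → term i j t u))
    expand t u = trans (reflexive (≡.cong fromℤ (expansion t u)))
      (trans (fromℤ-sum {size} _) (sum-cong-≋ λ i → trans (fromℤ-sum {size} _) (sum-cong-≋ λ j →
        trans (fromℤ-*ℕ (coeff i j ℤ.* + (u C toℕ j)) (t C toℕ i)) (*-congʳ (fromℤ-*ℕ (coeff i j) (u C toℕ j))))))
    evaluate : ∀ i j → umbral² N X Y (term i j) ≈ fromℤ (coeff i j) * X ^ toℕ i * Y ^ toℕ j
    evaluate i j = begin
      umbral² N X Y (term i j)
        ≈⟨ umbral²-* N X Y (λ u → fromℤ (coeff i j) * ((u C toℕ j) · 1#)) (λ t → (t C toℕ i) · 1#) ⟩
      umbral N Y (λ u → fromℤ (coeff i j) * ((u C toℕ j) · 1#)) * umbral N X (λ t → (t C toℕ i) · 1#)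
        ≈⟨ *-cong (trans (umbral-* N Y (fromℤ (coeff i j)) _) (*-congˡ (umbral-binomial N Y (toℕ j) (bound j))))
                  (umbral-binomial N X (toℕ i) (bound i)) ⟩
      fromℤ (coeff i j) * Y ^ toℕ j * X ^ toℕ i
        ≈⟨ xy∙z≈xz∙y _ _ _ ⟩
      fromℤ (coeff i j) * X ^ toℕ i * Y ^ toℕ j ∎
      where
      bound : ∀ (i : Fin size) → toℕ i < N
      bound i = ℕ.<-≤-trans (Fin.toℕ<n i) size≤N

  module _ {m} (M : Matroid (suc m)) (L : LatticeCount M) where
    open Matroid M

    -- By uniqueness of cardinality the values of `Q` are the explicit counts. Each contribution is
    -- a function of u times a function of t, so the operator factors and both factors are shifted
    -- binomials.
    Q′-sum : ∀ x y → Q′ L x y ≈ sumSubsets (λ A →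
      (1# + (y - 1#)) ^ β M A * (y - 1#) ^ (∣ A ∣ ∸ β M A) *
      ((1# + (x - 1#)) ^ (∣ ∁ A ∣ ∸ γ M A) * (x - 1#) ^ γ M A))
    Q′-sum x y = begin
      Q′ L x y
        ≈⟨ Q′-umbral L N (ℕ.m≤m+n _ (suc m)) x y ⟩
      umbral² N X Y (λ t u → Q t u · 1#)
        ≈⟨ umbral²-cong N X Y (λ t u → trans
             (reflexive (≡.cong (_· 1#) (card-unique (Q-counts t u) (card-lattice M t u))))
             (trans (fromℕ-subsetSum (count M t u))
               (sumSubsets-cong λ A → ×1-homo-* ((u ℕ.+ β M A) C ∣ A ∣) _))) ⟩
      umbral² N X Y (λ t u → sumSubsets (λ A → f A u * g A t))
        ≈⟨ umbral-cong N X (λ t → umbral-subsets N Y (λ A u → f A u * g A t)) ⟩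
      umbral N X (λ t → sumSubsets (λ A → umbral N Y (λ u → f A u * g A t)))
        ≈⟨ umbral-subsets N X (λ A t → umbral N Y (λ u → f A u * g A t)) ⟩
      sumSubsets (λ A → umbral² N X Y (λ t u → f A u * g A t))
        ≈⟨ sumSubsets-cong (λ A → trans (umbral²-* N X Y (f A) (g A)) (*-cong
             (umbral-shifted N Y (β M A) (∣ A ∣) (rank-≤ (outside ∷ A)) (small A))
             (trans (umbral-shifted N X (∣ ∁ A ∣ ∸ γ M A) (∣ ∁ A ∣) (ℕ.m∸n≤m _ (γ M A)) (small (∁ A)))
               (reflexive (≡.cong (λ k → (1# + X) ^ (∣ ∁ A ∣ ∸ γ M A) * X ^ k) (ℕ.m∸[m∸n]≡n (γ≤∣∁∣ M A))))))) ⟩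
      sumSubsets (λ A → (1# + Y) ^ β M A * Y ^ (∣ A ∣ ∸ β M A) * ((1# + X) ^ (∣ ∁ A ∣ ∸ γ M A) * X ^ γ M A)) ∎
      where
      open LatticeCount L
      X = x - 1#
      Y = y - 1#
      -- Large enough for the supplied expansion, which needs `size`, and for the explicit
      -- binomials, whose lower indices are at most `m`.
      N = size ℕ.+ suc m
      f g : Subset m → ℕ → Carrier
      f A u = ((u ℕ.+ β M A) C ∣ A ∣) · 1#
      g A t = ((t ℕ.+ (∣ ∁ A ∣ ∸ γ M A)) C ∣ ∁ A ∣) · 1#
      small : ∀ (A : Subset m) → ∣ A ∣ < N
      small A = ℕ.≤-trans (s≤s (Subset.∣p∣≤n A)) (ℕ.m≤n+m (suc m) size)

-- Sizes of complements and the rank increase caused by the first element.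

∣p∣+∣∁p∣≡n : ∀ {m} (A : Subset m) → ∣ A ∣ ℕ.+ ∣ ∁ A ∣ ≡ m
∣p∣+∣∁p∣≡n A = ≡.trans (≡.cong (∣ A ∣ ℕ.+_) (Subset.∣∁p∣≡n∸∣p∣ A)) (ℕ.m+[n∸m]≡n (Subset.∣p∣≤n A))

module Ranks {m} (M : Matroid (suc m)) where
  open import Data.Nat.Base using (_≤_; s≤s)
  open Matroid M
  open Counting

  -- Submodularity with the singleton of the first element allows an increase of at most one, and
  -- monotonicity excludes a decrease.
  rank-inside : ∀ A → rank (inside ∷ A) ≡ suc (β M A) ⊎ rank (inside ∷ A) ≡ β M A
  rank-inside A with ℕ.m≤n⇒m<n∨m≡n upper
    where
    open ℕ.≤-Reasoning
    upper : rank (inside ∷ A) ≤ suc (β M A)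
    upper = begin
      rank (inside ∷ A)                               ≡⟨ ≡.cong (λ B → rank (inside ∷ B)) (Subset.∪-identityˡ A) ⟨
      rank ((inside ∷ ⊥) ∪ (outside ∷ A))             ≤⟨ ℕ.m≤m+n _ _ ⟩
      rank ((inside ∷ ⊥) ∪ (outside ∷ A)) ℕ.+ rank ((inside ∷ ⊥) ∩ (outside ∷ A)) ≤⟨ rank-submod (inside ∷ ⊥) (outside ∷ A) ⟩
      rank (inside ∷ ⊥) ℕ.+ β M A                     ≤⟨ ℕ.+-monoˡ-≤ (β M A) (rank-≤ (inside ∷ ⊥)) ⟩
      ∣ inside ∷ ⊥ {m} ∣ ℕ.+ β M A                    ≡⟨ ≡.cong (λ k → suc k ℕ.+ β M A) (Subset.∣⊥∣≡0 m) ⟩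
      suc (β M A)                                     ∎
  ... | inj₂ eq = inj₁ eq
  ... | inj₁ (s≤s ρ≤β) = inj₂ (ℕ.≤-antisym ρ≤β (rank-mono (Subset.out⊆ (λ i∈A → i∈A))))

-- Substitution of the arguments and comparison with the Tutte polynomial.

module Assembly {c ℓ} (R : CommutativeRing c ℓ) where
  open import Data.Nat.Base using (_∸_)
  open Counting
  open Ranks
  open Bases using (a+b-b≡a)
  open Umbral R
  open CommutativeRing R hiding (zero)
    renaming (_+_ to infixl 6 _+_; _*_ to infixl 7 _*_; -_ to infix 8 -_)
  open Evaluation R hiding (fromℤ)
  open RawSemiring (Semiring.rawSemiring semiring) using (_^_)
  open RingProperties ring using (-‿distribˡ-*; -‿distribʳ-*; -‿involutive)
  open SemiringExp semiring using (^-homo-*; ^-congˡ)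
  open CommutativeSemiringExp commutativeSemiring using (^-distrib-*)
  open SemiringSolver commutativeSemiring using (solve; _:=_; _:*_; _:+_)
  open CommutativeSemigroup +-commutativeSemigroup
    using () renaming (interchange to +-interchange)
  open SetoidReasoning setoid

  1^k≈1 : ∀ k → 1# ^ k ≈ 1#
  1^k≈1 zero    = refl
  1^k≈1 (suc k) = trans (*-identityˡ _) (1^k≈1 k)

  val-^ᵘ : ∀ p k → val (p ^ᵘ k) ≈ val p ^ k
  val-^ᵘ p zero    = refl
  val-^ᵘ p (suc k) = *-congˡ (val-^ᵘ p k)

  inv-power : ∀ p k → inv (p ^ᶻ (+ suc k ℤ.- + 1)) * val p ^ k ≈ 1#
  inv-power p k = trans (*-comm _ _) (trans (*-congʳ (sym (val-^ᵘ p k))) (val*inv≈1# (p ^ᵘ k)))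

  -- This is p^k / p^(k-1) = p. At k = 0 the exponent of the denominator is -1, and inverting it
  -- returns p itself.
  inv-power-suc : ∀ p k → inv (p ^ᶻ (+ k ℤ.- + 1)) * val p ^ k ≈ val p
  inv-power-suc p zero    = trans (*-identityʳ _) (*-identityʳ _)
  inv-power-suc p (suc k) = begin
    inv (p ^ᵘ k) * (val p * val p ^ k)   ≈⟨ solve 3 (λ a b c → a :* (b :* c) := b :* (a :* c)) refl _ (val p) _ ⟩
    val p * (inv (p ^ᵘ k) * val p ^ k)   ≈⟨ *-congˡ (inv-power p k) ⟩
    val p * 1#                           ≈⟨ *-identityʳ (val p) ⟩
    val p                                ∎

  1+[a-1]≈a : ∀ a → 1# + (a - 1#) ≈ a
  1+[a-1]≈a a = trans (sym (+-assoc 1# a (- 1#))) (a+b-a≈b 1# a)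

  -- Over the common denominator w the claim is -a - w = -b(a - 1), which follows from the value of
  -- w. That value is symmetric in a and b, so the lemma serves both arguments of `Q′`.
  substitution : ∀ a b w → val w ≈ a * b - a - b → - a * inv w - 1# ≈ - b * (a - 1#) * inv w
  substitution a b w w≈ = begin
    - a * inv w - 1#                    ≈⟨ +-congˡ (trans (-‿cong (sym (val*inv≈1# w))) (-‿distribˡ-* (val w) (inv w))) ⟩
    - a * inv w + - val w * inv w       ≈⟨ distribʳ (inv w) (- a) (- val w) ⟨
    (- a - val w) * inv w               ≈⟨ *-congʳ (trans (+-congʳ (sym w+q≈-a)) (a+b-a≈b (val w) q)) ⟩
    q * inv w                           ∎
    where
    q = - b * (a - 1#)
    q≈ : q ≈ - (a * b) + b
    q≈ = begin
      - b * (a - 1#)                ≈⟨ distribˡ (- b) a (- 1#) ⟩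
      - b * a + - b * - 1#          ≈⟨ +-cong (trans (sym (-‿distribˡ-* b a)) (-‿cong (*-comm b a)))
                                              (trans (sym (-‿distribʳ-* (- b) 1#)) (trans (-‿cong (*-identityʳ (- b))) (-‿involutive b))) ⟩
      - (a * b) + b                 ∎
    w+q≈-a : val w + q ≈ - a
    w+q≈-a = begin
      val w + q                               ≈⟨ +-cong w≈ q≈ ⟩
      (a * b - a - b) + (- (a * b) + b)       ≈⟨ +-interchange (a * b - a) (- b) (- (a * b)) b ⟩
      (a * b - a - a * b) + (- b + b)         ≈⟨ +-cong (a+b-a≈b (a * b) (- a)) (-‿inverseˡ b) ⟩
      - a + 0#                                ≈⟨ +-identityʳ (- a) ⟩
      - a                                     ∎

  module _ {m} (M : Matroid (suc m)) (L : LatticeCount M) (x y w : Unit)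
           (w≈ : val w ≈ val x * val y - val x - val y) where
    open Matroid M

    private
      r = totalRank
      x′ = - val x
      y′ = - val y
      X = x′ * inv w
      Y = y′ * inv w
      ux = val x - 1#
      uy = val y - 1#
      Iy = inv ((-ᵘ y) ^ᶻ (+ r ℤ.- + 1))
      Ix = inv ((-ᵘ x) ^ᶻ (+ suc m ℤ.- + r ℤ.- + 1))
      P = val w ^ m * (Iy * Ix)

    term : Subset m → Carrier
    term A = (1# + (Y - 1#)) ^ β M A * (Y - 1#) ^ (∣ A ∣ ∸ β M A) *
             ((1# + (X - 1#)) ^ (∣ ∁ A ∣ ∸ γ M A) * (X - 1#) ^ γ M A)

    tutteTerm : Subset (suc m) → Carrier
    tutteTerm S = ux ^ (rank ⊤ ∸ rank S) * uy ^ (∣ S ∣ ∸ rank S)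

    module _ (A : Subset m) where
      private
        b = β M A
        g = γ M A
        α = ∣ A ∣ ∸ b
        δ = ∣ ∁ A ∣ ∸ g
        U = uy ^ α * ux ^ g

      -- These are the exponents with which 1/w enters `term A`; their sum |E| - 1 matches the power
      -- of w in the prefactor, so w disappears.
      degree : (b ℕ.+ α) ℕ.+ (δ ℕ.+ g) ≡ m
      degree = ≡.trans (≡.cong₂ ℕ._+_ (ℕ.m+[n∸m]≡n (rank-≤ (outside ∷ A))) (ℕ.m∸n+n≡m (γ≤∣∁∣ M A))) (∣p∣+∣∁p∣≡n A)

      -- The substitution crosses the variables: Y - 1 carries a factor -x and X - 1 a factor -y.
      -- Hence -y collects the exponents of Y and X - 1, and -x those of X and Y - 1.
      term-monomial : term A ≈ inv w ^ m * ((y′ ^ (b ℕ.+ g) * x′ ^ (α ℕ.+ δ)) * U)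
      term-monomial = begin
        term A
          ≈⟨ *-cong
               (*-cong (power b (1+[a-1]≈a Y)) (power₃ α (substitution (val y) (val x) w w≈′)))
               (*-cong (power δ (1+[a-1]≈a X)) (power₃ g (substitution (val x) (val y) w w≈))) ⟩
        (y′ ^ b * i ^ b) * ((x′ ^ α * uy ^ α) * i ^ α) * ((x′ ^ δ * i ^ δ) * ((y′ ^ g * ux ^ g) * i ^ g))
          ≈⟨ solve 10 (λ yb ib xa ua ia xd id yg ug ig →
               (yb :* ib) :* ((xa :* ua) :* ia) :* ((xd :* id) :* ((yg :* ug) :* ig)) :=
               ((ib :* ia) :* (id :* ig)) :* (((yb :* yg) :* (xa :* xd)) :* (ua :* ug)))
               refl (y′ ^ b) (i ^ b) (x′ ^ α) (uy ^ α) (i ^ α) (x′ ^ δ) (i ^ δ) (y′ ^ g) (ux ^ g) (i ^ g) ⟩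
        ((i ^ b * i ^ α) * (i ^ δ * i ^ g)) * (((y′ ^ b * y′ ^ g) * (x′ ^ α * x′ ^ δ)) * U)
          ≈⟨ *-cong i-power (*-congʳ (*-cong (sym (^-homo-* y′ b g)) (sym (^-homo-* x′ α δ)))) ⟩
        i ^ m * ((y′ ^ (b ℕ.+ g) * x′ ^ (α ℕ.+ δ)) * U) ∎
        where
        i = inv w
        w≈′ : val w ≈ val y * val x - val y - val x
        w≈′ = trans w≈ (trans (+-assoc _ _ _) (trans (+-cong (*-comm _ _) (+-comm _ _)) (sym (+-assoc _ _ _))))
        power : ∀ k {p q} → p ≈ q * i → p ^ k ≈ q ^ k * i ^ k
        power k {q = q} p≈ = trans (^-congˡ k p≈) (^-distrib-* q i k)
        power₃ : ∀ k {p q v} → p ≈ q * v * i → p ^ k ≈ (q ^ k * v ^ k) * i ^ k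
        power₃ k {q = q} {v} p≈ = trans (power k p≈) (*-congʳ (^-distrib-* q v k))
        i-power : (i ^ b * i ^ α) * (i ^ δ * i ^ g) ≈ i ^ m
        i-power = trans (*-cong (sym (^-homo-* i b α)) (sym (^-homo-* i δ g)))
          (trans (sym (^-homo-* i (b ℕ.+ α) (δ ℕ.+ g))) (reflexive (≡.cong (i ^_) degree)))

      scaled : P * term A ≈ ((Iy * y′ ^ (b ℕ.+ g)) * (Ix * x′ ^ (α ℕ.+ δ))) * U
      scaled = begin
        P * term A
          ≈⟨ *-congˡ term-monomial ⟩
        P * (inv w ^ m * ((y′ ^ (b ℕ.+ g) * x′ ^ (α ℕ.+ δ)) * U))
          ≈⟨ solve 7 (λ wm iy ix im ye xf u →
               (wm :* (iy :* ix)) :* (im :* ((ye :* xf) :* u)) := (wm :* im) :* (((iy :* ye) :* (ix :* xf)) :* u))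
               refl (val w ^ m) Iy Ix (inv w ^ m) (y′ ^ (b ℕ.+ g)) (x′ ^ (α ℕ.+ δ)) U ⟩
        (val w ^ m * inv w ^ m) * (((Iy * y′ ^ (b ℕ.+ g)) * (Ix * x′ ^ (α ℕ.+ δ))) * U)
          ≈⟨ *-congʳ (trans (sym (^-distrib-* (val w) (inv w) m)) (trans (^-congˡ m (val*inv≈1# w)) (1^k≈1 m))) ⟩
        1# * (((Iy * y′ ^ (b ℕ.+ g)) * (Ix * x′ ^ (α ℕ.+ δ))) * U)
          ≈⟨ *-identityˡ _ ⟩
        ((Iy * y′ ^ (b ℕ.+ g)) * (Ix * x′ ^ (α ℕ.+ δ))) * U ∎

      -- Replaces |E| - r by the natural number s, the form in which `inv-power` and `inv-power-suc`
      -- apply.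
      Ix-corank : ∀ {s} → s ℕ.+ r ≡ suc m → Ix ≡ inv ((-ᵘ x) ^ᶻ (+ s ℤ.- + 1))
      Ix-corank {s} s+r≡n = ≡.cong (λ k → inv ((-ᵘ x) ^ᶻ (k ℤ.- + 1)))
        (≡.trans (≡.cong (λ k → + k ℤ.- + r) (≡.sym s+r≡n)) (a+b-b≡a (+ s) (+ r)))

      -- The exponents of -y and -x in the numerator add up to |E| - 1 and those in the denominator
      -- to |E| - 2, so one factor survives; the overall minus sign makes it x or y.
      term-pair : - (P * term A) ≈ tutteTerm (outside ∷ A) + tutteTerm (inside ∷ A)
      term-pair with rank-inside M A
      -- Here b + g = r - 1 and α + δ = |E| - r, so the powers of -y cancel and x remains. In x = 1
      -- + (x - 1), the summand x - 1 belongs to A, whose corank is larger by one, and 1 belongs to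
      -- A ∪ e.
      ... | inj₁ ρ≡1+b = begin
        - (P * term A)
          ≈⟨ -‿cong (trans scaled (*-congʳ (*-cong y-part x-part))) ⟩
        - ((1# * x′) * U)
          ≈⟨ trans (-‿cong (*-congʳ (*-identityˡ x′))) (trans (-‿distribˡ-* x′ U) (*-congʳ (-‿involutive (val x)))) ⟩
        val x * U
          ≈⟨ *-congʳ (1+[a-1]≈a (val x)) ⟨
        (1# + ux) * U
          ≈⟨ trans (distribʳ U 1# ux) (+-congʳ (*-identityˡ U)) ⟩
        U + ux * U
          ≈⟨ solve 3 (λ u ya xg → (ya :* xg) :+ u :* (ya :* xg) := (u :* xg) :* ya :+ xg :* ya) refl ux (uy ^ α) (ux ^ g) ⟩
        ux ^ suc g * uy ^ α + ux ^ g * uy ^ α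
          ≡⟨ ≡.cong₂ (λ j k → ux ^ j * uy ^ α + ux ^ g * uy ^ k) r∸b (≡.cong (suc ∣ A ∣ ∸_) ρ≡1+b) ⟨
        tutteTerm (outside ∷ A) + tutteTerm (inside ∷ A) ∎
        where
        r≡ : suc (b ℕ.+ g) ≡ r
        r≡ = ≡.trans (≡.cong suc (ℕ.+-comm b g)) (≡.trans (≡.sym (ℕ.+-suc g b))
               (≡.trans (≡.cong (g ℕ.+_) (≡.sym ρ≡1+b)) (γ-exact M A)))
        regroup : ∀ b α δ g → α ℕ.+ δ ℕ.+ suc (b ℕ.+ g) ≡ suc ((b ℕ.+ α) ℕ.+ (δ ℕ.+ g))
        regroup = ℕ-Solver.solve-∀
        r∸b : r ∸ b ≡ suc g
        r∸b = ≡.trans (≡.cong (_∸ b) (≡.trans (≡.sym r≡) (≡.sym (ℕ.+-suc b g)))) (ℕ.m+n∸m≡n b (suc g))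
        y-part : Iy * y′ ^ (b ℕ.+ g) ≈ 1#
        y-part = trans (*-congʳ (reflexive (≡.cong (λ k → inv ((-ᵘ y) ^ᶻ (+ k ℤ.- + 1))) (≡.sym r≡)))) (inv-power (-ᵘ y) (b ℕ.+ g))
        x-part : Ix * x′ ^ (α ℕ.+ δ) ≈ x′
        x-part = trans (*-congʳ (reflexive (Ix-corank {α ℕ.+ δ} (≡.trans (≡.cong (α ℕ.+ δ ℕ.+_) (≡.sym r≡))
          (≡.trans (regroup b α δ g) (≡.cong suc degree)))))) (inv-power-suc (-ᵘ x) (α ℕ.+ δ))
      -- Here b + g = r and α + δ = |E| - r - 1, so y remains. In y = 1 + (y - 1), the summand 1
      -- belongs to A, and y - 1 belongs to A ∪ e, whose nullity is larger by one.
      ... | inj₂ ρ≡b = begin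
        - (P * term A)
          ≈⟨ -‿cong (trans scaled (*-congʳ (*-cong y-part x-part))) ⟩
        - ((y′ * 1#) * U)
          ≈⟨ trans (-‿cong (*-congʳ (*-identityʳ y′))) (trans (-‿distribˡ-* y′ U) (*-congʳ (-‿involutive (val y)))) ⟩
        val y * U
          ≈⟨ *-congʳ (1+[a-1]≈a (val y)) ⟨
        (1# + uy) * U
          ≈⟨ trans (distribʳ U 1# uy) (+-congʳ (*-identityˡ U)) ⟩
        U + uy * U
          ≈⟨ solve 3 (λ u ya xg → (ya :* xg) :+ u :* (ya :* xg) := xg :* ya :+ xg :* (u :* ya)) refl uy (uy ^ α) (ux ^ g) ⟩
        ux ^ g * uy ^ α + ux ^ g * uy ^ suc α
          ≡⟨ ≡.cong₂ (λ j k → ux ^ j * uy ^ α + ux ^ g * uy ^ k) r∸b 1+a∸ρ ⟨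
        tutteTerm (outside ∷ A) + tutteTerm (inside ∷ A) ∎
        where
        r≡ : b ℕ.+ g ≡ r
        r≡ = ≡.trans (ℕ.+-comm b g) (≡.trans (≡.cong (g ℕ.+_) (≡.sym ρ≡b)) (γ-exact M A))
        regroup′ : ∀ b α δ g → suc (α ℕ.+ δ) ℕ.+ (b ℕ.+ g) ≡ suc ((b ℕ.+ α) ℕ.+ (δ ℕ.+ g))
        regroup′ = ℕ-Solver.solve-∀
        r∸b : r ∸ b ≡ g
        r∸b = ≡.trans (≡.cong (_∸ b) (≡.sym r≡)) (ℕ.m+n∸m≡n b g)
        1+a∸ρ : suc ∣ A ∣ ∸ rank (inside ∷ A) ≡ suc α
        1+a∸ρ = ≡.trans (≡.cong (suc ∣ A ∣ ∸_) ρ≡b) (ℕ.+-∸-assoc 1 (rank-≤ (outside ∷ A)))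
        y-part : Iy * y′ ^ (b ℕ.+ g) ≈ y′
        y-part = trans (*-congʳ (reflexive (≡.cong (λ k → inv ((-ᵘ y) ^ᶻ (+ k ℤ.- + 1))) (≡.sym r≡)))) (inv-power-suc (-ᵘ y) (b ℕ.+ g))
        x-part : Ix * x′ ^ (α ℕ.+ δ) ≈ 1#
        x-part = trans (*-congʳ (reflexive (Ix-corank {suc (α ℕ.+ δ)} (≡.trans (≡.cong (suc (α ℕ.+ δ) ℕ.+_) (≡.sym r≡))
          (≡.trans (regroup′ b α δ g) (≡.cong suc degree)))))) (inv-power (-ᵘ x) (α ℕ.+ δ))

    tutte-formula : tutte M (val x) (val y) ≈ - (P * Q′ L X Y)
    tutte-formula = begin
      sumSubsets (λ A → tutteTerm (outside ∷ A)) + sumSubsets (λ A → tutteTerm (inside ∷ A))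
        ≈⟨ sumSubsets-+ (λ A → tutteTerm (outside ∷ A)) (λ A → tutteTerm (inside ∷ A)) ⟨
      sumSubsets (λ A → tutteTerm (outside ∷ A) + tutteTerm (inside ∷ A))
        ≈⟨ sumSubsets-cong (λ A → trans (sym (term-pair A)) (-‿distribˡ-* P (term A))) ⟩
      sumSubsets (λ A → - P * term A)
        ≈⟨ sumSubsets-* (- P) term ⟨
      - P * sumSubsets term
        ≈⟨ -‿distribˡ-* P (sumSubsets term) ⟨
      - (P * sumSubsets term)
        ≈⟨ -‿cong (*-congˡ (Q′-sum M L X Y)) ⟨
      - (P * Q′ L X Y) ∎

mainTheorem2 : ∀ {c ℓ} {n : ℕ} .{{_ : NonZero n}} (M : Matroid n) →
    LatticeCount M ×
    (∀ (L : LatticeCount M) (R : CommutativeRing c ℓ) → Evaluation.TutteFormula R M L)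
mainTheorem2 {n = suc m} M =
  Expansion.latticeCount M , λ L R x y w w≈ → Assembly.tutte-formula R M L x y w w≈
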